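{- Let $n\ge 5$ be an integer, and call an $n$-vertex graph extremal for $P^2_5$ if it contains no subgraph isomorphic to $P^2_5$ and has exactly $\mathrm{ex}(n,P^2_5)$ edges. Up to isomorphism: (i) for $n=5$ the extremal graphs for $P^2_5$ are exactly $E^2_5$, $E^3_5$ and $G_0$, where $G_0$ is $K_4$ together with one pendant edge (a fifth vertex joined to exactly one vertex of the $K_4$); (ii) for $n\ge 6$ with $n\equiv 1 \pmod 4$, the extremal graphs are exactly $E^{\lceil n/2\rceil}_n$ and $E^{\lfloor n/2\rfloor}_n$; (iii) for $n\ge 6$ with $n\equiv 2 \pmod 4$, the extremal graphs are exactly $E^{n/2}_n$ and $E^{n/2+1}_n$; (iv) for $n\ge 6$ with $n\equiv 0,3\pmod 4$, the only extremal graph is $E^{\lceil n/2\rceil}_n$.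
   Context: All graphs are finite, simple and undirected. $P^2_k$ is the square of the path on $k$ vertices $v_1,\dots,v_k$: $v_i,v_j$ adjacent iff $1\le|i-j|\le 2$. $\mathrm{ex}(n,H)$ is the maximum number of edges in an $n$-vertex graph not containing $H$ as a subgraph. For $1\le i\le n-1$, $E^i_n$ denotes the graph obtained from the complete bipartite graph $K_{i,n-i}$ with classes $X$ ($|X|=i$) and $Y$ ($|Y|=n-i$) by adding a maximum matching inside $X$ (i.e. $\lfloor i/2\rfloor$ pairwise disjoint edges with both ends in $X$). -}

module Defs where

open import Data.Nat using (ℕ; zero; suc; _≡ᵇ_; _<ᵇ_; _≤ᵇ_; ∣_-_∣; ⌊_/2⌋)
open import Data.Bool using (Bool; true; false; not; _∧_; _∨_; _xor_; if_then_else_)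
open import Data.Bool.Properties using (∨-comm)
open import Data.Fin using (Fin; toℕ)
open import Data.List using (List; map; allFin; cartesianProduct)
open import Data.Nat.ListAction using (sum)
open import Data.Product using (Σ; _×_; _,_)
open import Function.Definitions using (Injective)
open import Relation.Binary.PropositionalEquality using (_≡_; refl; cong₂)

record Graph (n : ℕ) : Set where
  field
    adj    : Fin n → Fin n → Bool
    sym    : ∀ i j → adj i j ≡ adj j i
    irrefl : ∀ i → adj i i ≡ false
open Graph public

≡ᵇ-sym : ∀ m n → (m ≡ᵇ n) ≡ (n ≡ᵇ m)
≡ᵇ-sym zero zero = refl
≡ᵇ-sym zero (suc n) = refl
≡ᵇ-sym (suc m) zero = refl
≡ᵇ-sym (suc m) (suc n) = ≡ᵇ-sym m n

≡ᵇ-refl : ∀ m → (m ≡ᵇ m) ≡ true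
≡ᵇ-refl zero = refl
≡ᵇ-refl (suc m) = ≡ᵇ-refl m

fromRel : ∀ {n} → (Fin n → Fin n → Bool) → Graph n
fromRel {n} r = record { adj = a ; sym = s ; irrefl = ir }
  where
  a : Fin n → Fin n → Bool
  a i j = (r i j ∨ r j i) ∧ not (toℕ i ≡ᵇ toℕ j)
  s : ∀ i j → a i j ≡ a j i
  s i j = cong₂ (λ x y → x ∧ not y) (∨-comm (r i j) (r j i)) (≡ᵇ-sym (toℕ i) (toℕ j))
  ir : ∀ i → a i i ≡ false
  ir i rewrite ≡ᵇ-refl (toℕ i) with r i i ∨ r i i
  ... | true = refl
  ... | false = refl

edges : ∀ {n} → Graph n → ℕ
edges {n} G = sum (map count (cartesianProduct (allFin n) (allFin n)))
  where
  count : Fin n × Fin n → ℕ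
  count (i , j) = if adj G i j ∧ (toℕ i <ᵇ toℕ j) then 1 else 0

_⊆ᵍ_ : ∀ {m n} → Graph m → Graph n → Set
_⊆ᵍ_ {m} {n} H G = Σ (Fin m → Fin n) λ f →
  Injective _≡_ _≡_ f × (∀ i j → adj H i j ≡ true → adj G (f i) (f j) ≡ true)

record _≅_ {n : ℕ} (G H : Graph n) : Set where
  field
    to      : Fin n → Fin n
    from    : Fin n → Fin n
    from∘to : ∀ i → from (to i) ≡ i
    to∘from : ∀ i → to (from i) ≡ i
    pres    : ∀ i j → adj G i j ≡ adj H (to i) (to j)

P² : (k : ℕ) → Graph k
P² k = fromRel λ i j → (1 ≤ᵇ ∣ toℕ i - toℕ j ∣) ∧ (∣ toℕ i - toℕ j ∣ ≤ᵇ 2)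

-- E^i_n: X = {v : toℕ v < i}, Y = the rest; complete bipartite between X and Y,
-- plus the maximum matching {2t, 2t+1} (both < i) inside X.
E : (n i : ℕ) → Graph n
E n i = fromRel λ u v →
  let x = toℕ u <ᵇ i ; y = toℕ v <ᵇ i in
  (x xor y) ∨ (x ∧ y ∧ (⌊ toℕ u /2⌋ ≡ᵇ ⌊ toℕ v /2⌋))

G₀ : Graph 5
G₀ = fromRel λ u v →
  ((toℕ u <ᵇ 4) ∧ (toℕ v <ᵇ 4)) ∨ ((toℕ u ≡ᵇ 3) ∧ (toℕ v ≡ᵇ 4))

P²₅-free : ∀ {n} → Graph n → Set
P²₅-free G = P² 5 ⊆ᵍ G → Data.Empty.⊥
  where import Data.Empty

Extremal : ∀ {n} → Graph n → Set
Extremal {n} G = P²₅-free G × (∀ (H : Graph n) → P²₅-free H → Data.Nat._≤_ (edges H) (edges G))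
  where import Data.Nat

{-# OPTIONS --safe #-}

-- P²₅ is the fan K₁ ∨ P₄. In a P²₅-free graph a vertex outside a K₄ sends at most one edge to it, and,
-- if there is no K₄, a vertex outside a diamond sends it at most two. Induction gives 4e ≤ n(n + 1) for K₄-free
-- graphs, and for all graphs when n ≥ 5. If equality holds up to rounding, then (apart from K₄ with a
-- pendant edge) there is a diamond, with non-adjacent vertices a, b and adjacent c, d, and every vertex is
-- adjacent to both a and b or to both c and d. Hence X = N(a) spans a matching, as otherwise there is a fan
-- through a and b, and its complement is independent, as otherwise there is a K₄ through c and d.
-- Counting edges then forces all X–Y edges, a maximum matching in X, and the size of X.
module Submission where

open import Defs
open import Data.Bool using (Bool; true; false; not; T; _∧_; _∨_; if_then_else_)
open import Data.Bool.Properties using (¬-not; ∧-identityʳ; ∧-zeroʳ; ∨-idem) renaming (_≟_ to _≟ᵇ_)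
open import Data.Empty using (⊥; ⊥-elim)
open import Data.Fin using (Fin; zero; suc; toℕ; cast)
open import Data.Fin.Properties using (_≟_; toℕ-injective; toℕ-cast)
open import Data.List using (List; []; _∷_; _++_; length; map; lookup; allFin; tabulate; cartesianProduct)
open import Data.List.Membership.Propositional using (_∈_; find; lose)
open import Data.List.Membership.Propositional.Properties using (∈-∃++; ∈-map⁻; ∈-allFin; ∈-lookup; ∈-++⁺ʳ; ∈-++⁻)
open import Data.List.Properties using (length-map; length-++; map-++; map-∘; map-tabulate; tabulate-cong; length-tabulate; ++-identityʳ)
open import Data.List.Relation.Binary.Permutation.Propositional using (_↭_; ↭-sym; ↭-trans; prep; swap; refl; trans; ↭⇒↭ₛ)
open import Data.List.Relation.Binary.Permutation.Propositional.Properties using (shift; ∈-resp-↭; All-resp-↭; ↭-length; map⁺; ++⁺ʳ; ++-comm)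
import Data.List.Relation.Binary.Permutation.Setoid.Properties as Permₛ
open import Data.List.Relation.Unary.All as All using (All; []; _∷_)
open import Data.List.Relation.Unary.All.Properties using (++⁺; ++⁻ʳ)
open import Data.List.Relation.Unary.AllPairs using (AllPairs; []; _∷_)
open import Data.List.Relation.Unary.AllPairs.Properties using (tabulate⁺-<)
open import Data.List.Relation.Unary.Any using (Any; here; there; any?)
open import Data.List.Relation.Unary.Unique.Propositional using (Unique)
open import Data.List.Relation.Unary.Unique.Propositional.Properties using (allFin⁺) renaming (map⁺ to Unique-map⁺)
open import Data.Nat using (ℕ; zero; suc; _+_; _*_; _≤_; _<_; z≤n; s≤s; pred; _%_; _∸_; _⊓_; ⌊_/2⌋; ⌈_/2⌉; _<ᵇ_; _≡ᵇ_)
open import Data.Nat.DivMod using (m≡m%n+[m/n]*n; [m+kn]%n≡m%n; m%n<n; _/_)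
open import Data.Nat.ListAction using (sum)
open import Data.Nat.ListAction.Properties using (sum-↭; sum-++)
open import Data.Nat.Properties hiding (_≟_)
open import Data.Nat.Tactic.RingSolver using (solve-∀)
open import Data.Product using (∃; ∃₂; _×_; _,_; proj₁; proj₂)
open import Data.Sum using (_⊎_; inj₁; inj₂)
open import Data.Vec using (Vec; []; _∷_)
open import Data.Vec.Relation.Unary.All as VAll using ([]; _∷_)
open import Function using (_∘_; id)
open import Function.Bundles using (_⇔_; mk⇔)
open import Function.Definitions using (Injective)
open import Relation.Binary.Definitions using (tri<; tri≈; tri>)
open import Relation.Binary.PropositionalEquality hiding (sym) renaming (trans to ≡-trans)
open import Relation.Binary.PropositionalEquality using () renaming (sym to ≡-sym)
open import Relation.Nullary using (Dec; yes; no; ¬_; contradiction)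
open import Relation.Nullary.Decidable using (map′; _×-dec_; ¬?)

import Data.List.Relation.Binary.Permutation.Setoid.Properties as Permₛ

-- The bound n(n + 1)/4 is the one that deleting a diamond preserves exactly: with m = n - 4
-- vertices left, 5 + 2m edges are lost, and 20 + 8m + m(m + 1) = (m + 4)(m + 5). A graph with 4e >
-- n(n + 1) - 4 therefore cannot waste a single edge at a diamond, so each outside vertex sends it
-- exactly two edges; this is the source of the two-sided structure. The obstacle is K₄, where 4 · 6
-- exceeds 4 · 5 by 4. The bound is proved for all graphs with an allowance of 4, and deleting a K₄
-- with m vertices left wins back 4 · min(m, 2). For m = 1 this restores the bound and leaves room
-- for the pendant edge; for m ≥ 2 it pushes every graph with a K₄ below the threshold. No formula
-- for ex(n, P²₅) is needed: both directions pass through n(n + 1) < 4 + 4e, which the listed E^i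
-- satisfy. All counts refer to vertex lists inside one fixed graph, so the inductions never
-- construct induced subgraphs.

𝟙 : Bool → ℕ
𝟙 b = if b then 1 else 0

-- Duplicate-free lists, pattern search and sums

module _ {A : Set} where

  Unique-resp-↭ : {xs ys : List A} → xs ↭ ys → Unique xs → Unique ys
  Unique-resp-↭ p = Permₛ.Unique-resp-↭ (setoid A) (↭⇒↭ₛ p)

  Unique-++⁻ : ∀ T {U : List A} → Unique (T ++ U) → Unique U × All (λ v → All (λ t → ¬ t ≡ v) T) U
  Unique-++⁻ [] u = u , All.universal (λ _ → []) _
  Unique-++⁻ (t ∷ T) (t≢ ∷ u) with Unique-++⁻ T u
  ... | uU , disj = uU , All.zipWith (λ (p , q) → p ∷ q) (++⁻ʳ T t≢ , disj)

  extract : {ts xs : List A} → Unique ts → All (_∈ xs) ts → ∃ λ ys → xs ↭ ts ++ ys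
  extract {xs = xs} [] [] = xs , refl
  extract {t ∷ ts} (t≢ts ∷ uts) (t∈xs ∷ ts⊆xs) with ∈-∃++ t∈xs
  ... | as , bs , refl
    with extract uts (All.zipWith (λ (t≢x , x∈) → remove t≢x x∈) (t≢ts , ts⊆xs))
    where
    remove : ∀ {x} → ¬ t ≡ x → x ∈ as ++ t ∷ bs → x ∈ as ++ bs
    remove t≢x x∈ with ∈-resp-↭ (shift t as bs) x∈
    ... | here x≡t = contradiction (≡-sym x≡t) t≢x
    ... | there x∈′ = x∈′
  ...   | ys , p = ys , ↭-trans (shift t as bs) (prep t p)

  lookup-injective : {S : List A} → Unique S → Injective _≡_ _≡_ (lookup S)
  lookup-injective (_ ∷ _) {zero} {zero} _ = refl
  lookup-injective (x≢S ∷ _) {zero} {suc q} eq = contradiction eq (All.lookup x≢S (∈-lookup q))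
  lookup-injective (x≢S ∷ _) {suc p} {zero} eq = contradiction (≡-sym eq) (All.lookup x≢S (∈-lookup p))
  lookup-injective (_ ∷ uS) {suc p} {suc q} eq = cong suc (lookup-injective uS eq)

  -- Entries of the tuple may coincide, so distinctness has to come from `R`. Adjacency supplies it,
  -- except for the two tips of a diamond.
  Occurs : ∀ {k} → (Vec A k → Set) → List A → Set
  Occurs R S = ∃ λ t → VAll.All (_∈ S) t × R t

  occurs? : ∀ {k} {R : Vec A k → Set} → (∀ t → Dec (R t)) → ∀ S → Dec (Occurs R S)
  occurs? {zero} R? S = map′ (λ r → [] , [] , r) (λ { ([] , _ , r) → r }) (R? [])
  occurs? {suc k} {R} R? S = map′ to from (any? (λ x → occurs? (λ t → R? (x ∷ t)) S) S)
    where
    to : Any (λ x → Occurs (λ t → R (x ∷ t)) S) S → Occurs R S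
    to any with find any
    ... | x , x∈ , t , t⊆ , r = x ∷ t , x∈ ∷ t⊆ , r
    from : Occurs R S → Any (λ x → Occurs (λ t → R (x ∷ t)) S) S
    from (x ∷ t , x∈ ∷ t⊆ , r) = lose x∈ (t , t⊆ , r)

  occurs-mono : ∀ {k} {R : Vec A k → Set} {S T} → (∀ {x} → x ∈ S → x ∈ T) → Occurs R S → Occurs R T
  occurs-mono S⊆T (t , t⊆S , r) = t , VAll.map S⊆T t⊆S , r

  sum-map-+ : (f g : A → ℕ) (xs : List A) →
    sum (map (λ x → f x + g x) xs) ≡ sum (map f xs) + sum (map g xs)
  sum-map-+ f g [] = refl
  sum-map-+ f g (x ∷ xs) rewrite sum-map-+ f g xs = rearrange (f x) (g x) _ _
    where
    rearrange : ∀ a b c d → a + b + (c + d) ≡ a + c + (b + d)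
    rearrange = solve-∀

  sum-map-cong : {f g : A → ℕ} {xs : List A} → All (λ x → f x ≡ g x) xs → sum (map f xs) ≡ sum (map g xs)
  sum-map-cong [] = refl
  sum-map-cong (p ∷ ps) = cong₂ _+_ p (sum-map-cong ps)

  sum-map-≤ : {f : A → ℕ} {k : ℕ} {xs : List A} → All (λ x → f x ≤ k) xs → sum (map f xs) ≤ length xs * k
  sum-map-≤ [] = z≤n
  sum-map-≤ (p ∷ ps) = +-mono-≤ p (sum-map-≤ ps)

  sum-map-≡ : {f : A → ℕ} {k : ℕ} {xs : List A} → All (λ x → f x ≡ k) xs → sum (map f xs) ≡ length xs * k
  sum-map-≡ [] = refl
  sum-map-≡ (p ∷ ps) = cong₂ _+_ p (sum-map-≡ ps)

  -- The equality case of `sum-map-≤`; it turns a tight edge count into exact degrees.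
  sum-map-max : {f : A → ℕ} {k : ℕ} {xs : List A} → All (λ x → f x ≤ k) xs →
    length xs * k ≤ sum (map f xs) → All (λ x → f x ≡ k) xs
  sum-map-max [] _ = []
  sum-map-max {f} {k} {x ∷ xs} (p ∷ ps) max =
    ≤-antisym p (+-cancelʳ-≤ _ _ _ (≤-trans (+-monoʳ-≤ k (sum-map-≤ ps)) max))
    ∷ sum-map-max ps (+-cancelˡ-≤ _ _ _ (≤-trans max (+-monoˡ-≤ _ p)))

-- Degrees and edge counts on vertex lists

module _ {n : ℕ} (G : Graph n) where

  deg : Fin n → List (Fin n) → ℕ
  deg v S = sum (map (λ w → 𝟙 (adj G v w)) S)

  -- Each pair is counted at its earlier entry, so on a duplicate-free list this is the number of
  -- edges spanned by the list.
  e : List (Fin n) → ℕ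
  e [] = 0
  e (v ∷ S) = deg v S + e S

  deg-++ : ∀ v S T → deg v (S ++ T) ≡ deg v S + deg v T
  deg-++ v S T rewrite map-++ (λ w → 𝟙 (adj G v w)) S T = sum-++ (map _ S) _

  e-++ : ∀ S T → e (S ++ T) ≡ e S + (sum (map (λ v → deg v S) T) + e T)
  e-++ [] T = cong (_+ e T) (≡-sym (≡-trans (sum-map-≡ {k = 0} (All.universal (λ _ → refl) T)) (*-zeroʳ (length T))))
  e-++ (v ∷ S) T = begin
    deg v (S ++ T) + e (S ++ T)
      ≡⟨ cong₂ _+_ (deg-++ v S T) (e-++ S T) ⟩
    deg v S + deg v T + (e S + (sum (map (λ w → deg w S) T) + e T))
      ≡⟨ rearrange (deg v S) (deg v T) (e S) _ (e T) ⟩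
    deg v S + e S + (deg v T + sum (map (λ w → deg w S) T) + e T)
      ≡⟨ cong (λ s → deg v S + e S + (s + sum (map (λ w → deg w S) T) + e T))
           (sum-map-cong {xs = T} (All.universal (λ w → cong 𝟙 (sym G v w)) T)) ⟩
    deg v S + e S + (sum (map (λ w → 𝟙 (adj G w v)) T) + sum (map (λ w → deg w S) T) + e T)
      ≡⟨ cong (λ s → deg v S + e S + (s + e T)) (sum-map-+ _ _ T) ⟨
    deg v S + e S + (sum (map (λ w → deg w (v ∷ S)) T) + e T) ∎
    where
    open ≡-Reasoning
    rearrange : ∀ a b c d f → a + b + (c + (d + f)) ≡ a + c + (b + d + f)
    rearrange = solve-∀

  e-↭ : ∀ {S T} → S ↭ T → e S ≡ e T
  e-↭ refl = refl
  e-↭ (prep x p) = cong₂ _+_ (sum-↭ (map⁺ _ p)) (e-↭ p)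
  e-↭ {x ∷ y ∷ S} (swap x y p) rewrite sum-↭ (map⁺ (λ w → 𝟙 (adj G x w)) p) | sum-↭ (map⁺ (λ w → 𝟙 (adj G y w)) p) | e-↭ p | sym G x y =
    rearrange (𝟙 (adj G y x)) _ _ _
    where
    rearrange : ∀ a b c d → a + b + (c + d) ≡ a + c + (b + d)
    rearrange = solve-∀
  e-↭ (trans p q) = ≡-trans (e-↭ p) (e-↭ q)

  e-extract-≤ : ∀ {S T U k} → S ↭ T ++ U → All (λ v → deg v T ≤ k) U → e S ≤ e T + (length U * k + e U)
  e-extract-≤ {S} {T} {U} {k} p small = begin
    e S                                        ≡⟨ e-↭ p ⟩
    e (T ++ U)                                 ≡⟨ e-++ T U ⟩
    e T + (sum (map (λ v → deg v T) U) + e U)  ≤⟨ +-monoʳ-≤ (e T) (+-monoˡ-≤ (e U) (sum-map-≤ small)) ⟩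
    e T + (length U * k + e U)                 ∎
    where open ≤-Reasoning

-- Fans, small subgraphs and their deletion

module _ {n : ℕ} (G : Graph n) where

  infix 4 _~_
  _~_ : Fin n → Fin n → Set
  u ~ v = adj G u v ≡ true

  _~?_ : ∀ u v → Dec (u ~ v)
  u ~? v = adj G u v ≟ᵇ true

  ~-sym : ∀ {u v} → u ~ v → v ~ u
  ~-sym {u} {v} u~v = ≡-trans (sym G v u) u~v

  ~⇒≢ : ∀ {u v} → u ~ v → ¬ u ≡ v
  ~⇒≢ {u} u~u refl with ≡-trans (≡-sym (irrefl G u)) u~u
  ... | ()

  -- P²₅ is the join of its middle vertex with the path formed by the other four vertices.
  FanFree : Set
  FanFree = ∀ c p q r s → c ~ p → c ~ q → c ~ r → c ~ s → p ~ q → q ~ r → r ~ s →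
    ¬ p ≡ r → ¬ p ≡ s → ¬ q ≡ s → ⊥

  IsEdge : Vec (Fin n) 2 → Set
  IsEdge (u ∷ v ∷ []) = u ~ v

  IsTriangle : Vec (Fin n) 3 → Set
  IsTriangle (x ∷ y ∷ z ∷ []) = x ~ y × x ~ z × y ~ z

  IsK₄ : Vec (Fin n) 4 → Set
  IsK₄ (a ∷ b ∷ c ∷ d ∷ []) = a ~ b × a ~ c × a ~ d × b ~ c × b ~ d × c ~ d

  -- The spine `c`, `d` precedes the tips `a`, `b`. The tips may be adjacent; where they must not
  -- be, the absence of a K₄ is invoked.
  IsDiamond : Vec (Fin n) 4 → Set
  IsDiamond (c ∷ d ∷ a ∷ b ∷ []) = c ~ d × c ~ a × c ~ b × d ~ a × d ~ b × ¬ a ≡ b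

  isEdge? : ∀ t → Dec (IsEdge t)
  isEdge? (u ∷ v ∷ []) = u ~? v

  isTriangle? : ∀ t → Dec (IsTriangle t)
  isTriangle? (x ∷ y ∷ z ∷ []) = x ~? y ×-dec x ~? z ×-dec y ~? z

  isK₄? : ∀ t → Dec (IsK₄ t)
  isK₄? (a ∷ b ∷ c ∷ d ∷ []) = a ~? b ×-dec a ~? c ×-dec a ~? d ×-dec b ~? c ×-dec b ~? d ×-dec c ~? d

  isDiamond? : ∀ t → Dec (IsDiamond t)
  isDiamond? (c ∷ d ∷ a ∷ b ∷ []) =
    c ~? d ×-dec c ~? a ×-dec c ~? b ×-dec d ~? a ×-dec d ~? b ×-dec ¬? (a ≟ b)

  deg-none : ∀ {v S} → All (λ w → adj G v w ≡ false) S → deg G v S ≡ 0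
  deg-none {S = S} none = ≡-trans (sum-map-≡ (All.map (cong 𝟙) none)) (*-zeroʳ (length S))

  e-none : ∀ S → ¬ Occurs IsEdge S → e G S ≡ 0
  e-none [] _ = refl
  e-none (v ∷ S) none = cong₂ _+_
    (deg-none (All.tabulate λ {w} w∈ → ¬-not λ v~w → none (v ∷ w ∷ [] , here refl ∷ there w∈ ∷ [] , v~w)))
    (e-none S (none ∘ occurs-mono there))

  deg≤1 : ∀ {v S} → AllPairs (λ x y → v ~ x → v ~ y → ⊥) S → deg G v S ≤ 1
  deg≤1 [] = z≤n
  deg≤1 {v} {x ∷ S} (p ∷ ps) with adj G v x in v~x
  ... | false = deg≤1 ps
  ... | true = s≤s (≤-reflexive (deg-none (All.map (λ q → ¬-not (q refl)) p)))

  -- Bookkeeping for deleting `T` from `S`: as built by `split`, `c` bounds the edges inside `T` and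
  -- `d` the number of neighbours in `T` of any other vertex of `S`. The extremal structure is later
  -- read off from `tight`.
  record Split (S T : List (Fin n)) (c d : ℕ) : Set where
    field
      rest        : List (Fin n)
      rest-unique : Unique rest
      rest⊆       : ∀ {v} → v ∈ rest → v ∈ S
      length-S    : length S ≡ length T + length rest
      e-≤         : e G S ≤ c + (length rest * d + e G rest)
      tight       : c + (length rest * d + e G rest) ≤ e G S →
                    ∀ {v} → v ∈ S → All (λ t → ¬ t ≡ v) T → deg G v T ≡ d

  split : ∀ {S c d} T → Unique S → Unique T → All (_∈ S) T → e G T ≤ c →
    (∀ {v} → v ∈ S → All (λ t → ¬ t ≡ v) T → deg G v T ≤ d) → Split S T c d
  split {S} {c} {d} T uS uT T⊆S eT≤c small with extract uT T⊆S
  ... | U , p with Unique-++⁻ T (Unique-resp-↭ p uS)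
  ...   | uU , disj = record
    { rest = U
    ; rest-unique = uU
    ; rest⊆ = U⊆S
    ; length-S = ≡-trans (↭-length p) (length-++ T)
    ; e-≤ = ≤-trans (e-extract-≤ G p smallU) (+-monoˡ-≤ _ eT≤c)
    ; tight = tight
    }
    where
    U⊆S : ∀ {v} → v ∈ U → v ∈ S
    U⊆S v∈ = ∈-resp-↭ (↭-sym p) (∈-++⁺ʳ T v∈)
    smallU : All (λ v → deg G v T ≤ d) U
    smallU = All.tabulate λ v∈ → small (U⊆S v∈) (All.lookup disj v∈)
    tight : c + (length U * d + e G U) ≤ e G S → ∀ {v} → v ∈ S → All (λ t → ¬ t ≡ v) T → deg G v T ≡ d
    tight max v∈S v∉T with ∈-++⁻ T (∈-resp-↭ p v∈S)
    ... | inj₁ v∈T = contradiction refl (All.lookup v∉T v∈T)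
    ... | inj₂ v∈U = All.lookup (sum-map-max smallU (+-cancelʳ-≤ (e G U) _ _ (+-cancelˡ-≤ c _ _ (begin
      c + (length U * d + e G U)                         ≤⟨ max ⟩
      e G S                                              ≡⟨ ≡-trans (e-↭ G p) (e-++ G T U) ⟩
      e G T + (sum (map (λ v → deg G v T) U) + e G U)    ≤⟨ +-monoˡ-≤ _ eT≤c ⟩
      c + (sum (map (λ v → deg G v T) U) + e G U)        ∎)))) v∈U
      where open ≤-Reasoning

  e-edge : ∀ {u v} → u ~ v → e G (u ∷ v ∷ []) ≡ 1
  e-edge u~v rewrite u~v = refl

  e-triangle : ∀ {x y z} → IsTriangle (x ∷ y ∷ z ∷ []) → e G (x ∷ y ∷ z ∷ []) ≡ 3
  e-triangle (xy , xz , yz) rewrite xy | xz | yz = refl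

  e-K₄ : ∀ {a b c d} → IsK₄ (a ∷ b ∷ c ∷ d ∷ []) → e G (a ∷ b ∷ c ∷ d ∷ []) ≡ 6
  e-K₄ (ab , ac , ad , bc , bd , cd) rewrite ab | ac | ad | bc | bd | cd = refl

  e-diamond : ∀ {c d a b} → IsDiamond (c ∷ d ∷ a ∷ b ∷ []) → adj G a b ≡ false →
    e G (c ∷ d ∷ a ∷ b ∷ []) ≡ 5
  e-diamond (cd , ca , cb , da , db , _) ab rewrite cd | ca | cb | da | db | ab = refl

  -- Having a neighbour in each of {c, d} and {a, b} creates a fan.
  diamond-deg : FanFree → ∀ {c d a b v} → IsDiamond (c ∷ d ∷ a ∷ b ∷ []) → All (λ t → ¬ t ≡ v) (c ∷ d ∷ a ∷ b ∷ []) →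
    let D = deg G v (c ∷ d ∷ a ∷ b ∷ []) in
    D ≤ 2 × (D ≡ 2 → (v ~ a → v ~ b) × (adj G v a ≡ false → v ~ c × v ~ d))
  diamond-deg free {c} {d} {a} {b} {v} (cd , ca , cb , da , db , a≢b) (c≢v ∷ d≢v ∷ a≢v ∷ b≢v ∷ []) =
    cases (adj G v c) (adj G v d) (adj G v a) (adj G v b)
      (mixed cd ca cb da db a≢b b≢v d≢v) (mixed cd cb ca db da (a≢b ∘ ≡-sym) a≢v d≢v)
      (mixed (~-sym cd) da db ca cb a≢b b≢v c≢v) (mixed (~-sym cd) db da cb ca (a≢b ∘ ≡-sym) a≢v c≢v)
    where
    -- The fan has centre `c` and path `v`, `a`, `d`, `b`. Swapping `c` with `d` and `a` with `b`
    -- gives the other three mixed pairs.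
    mixed : ∀ {c d a b} → c ~ d → c ~ a → c ~ b → d ~ a → d ~ b → ¬ a ≡ b → ¬ b ≡ v → ¬ d ≡ v → v ~ c → v ~ a → ⊥
    mixed cd ca cb da db a≢b b≢v d≢v vc va =
      free _ _ _ _ _ (~-sym vc) ca cd cb va (~-sym da) db (d≢v ∘ ≡-sym) (b≢v ∘ ≡-sym) a≢b
    -- With mixed pairs excluded, the neighbours of `v` lie within `c`, `d` or within `a`, `b`, so
    -- two of them exhaust one pair.
    cases : ∀ c d a b → (c ≡ true → a ≡ true → ⊥) → (c ≡ true → b ≡ true → ⊥) →
      (d ≡ true → a ≡ true → ⊥) → (d ≡ true → b ≡ true → ⊥) →
      let D = 𝟙 c + (𝟙 d + (𝟙 a + (𝟙 b + 0))) in
      D ≤ 2 × (D ≡ 2 → (a ≡ true → b ≡ true) × (a ≡ false → c ≡ true × d ≡ true))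
    cases true  d     true  b     ca cb da db = ⊥-elim (ca refl refl)
    cases true  d     false true  ca cb da db = ⊥-elim (cb refl refl)
    cases true  true  false false ca cb da db = ≤-refl , λ _ → (λ ()) , λ _ → refl , refl
    cases true  false false false ca cb da db = s≤s z≤n , λ ()
    cases false true  true  b     ca cb da db = ⊥-elim (da refl refl)
    cases false true  false true  ca cb da db = ⊥-elim (db refl refl)
    cases false true  false false ca cb da db = s≤s z≤n , λ ()
    cases false false true  true  ca cb da db = ≤-refl , λ _ → (λ _ → refl) , λ ()
    cases false false true  false ca cb da db = s≤s z≤n , λ ()
    cases false false false true  ca cb da db = s≤s z≤n , λ ()
    cases false false false false ca cb da db = z≤n , λ ()

  edge-split : ∀ {S u v} → Unique S → ¬ Occurs IsTriangle S → u ∈ S → v ∈ S → u ~ v → Split S (u ∷ v ∷ []) 1 1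
  edge-split {u = u} {v} uS noΔ u∈ v∈ u~v =
    split (u ∷ v ∷ []) uS ((~⇒≢ u~v ∷ []) ∷ [] ∷ []) (u∈ ∷ v∈ ∷ []) (≤-reflexive (e-edge u~v))
      λ w∈ _ → deg≤1 (((λ w~u w~v → noΔ (_ , w∈ ∷ u∈ ∷ v∈ ∷ [] , w~u , w~v , u~v)) ∷ []) ∷ [] ∷ [])

  -- A vertex seeing two vertices of the triangle forms a diamond with that edge as spine, the third
  -- vertex being the other tip.
  triangle-split : ∀ {S x y z} → Unique S → ¬ Occurs IsDiamond S → x ∈ S → y ∈ S → z ∈ S →
    IsTriangle (x ∷ y ∷ z ∷ []) → Split S (x ∷ y ∷ z ∷ []) 3 1
  triangle-split {S} {x} {y} {z} uS no◇ x∈ y∈ z∈ (xy , xz , yz) =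
    split (x ∷ y ∷ z ∷ []) uS ((~⇒≢ xy ∷ ~⇒≢ xz ∷ []) ∷ (~⇒≢ yz ∷ []) ∷ [] ∷ []) (x∈ ∷ y∈ ∷ z∈ ∷ [])
      (≤-reflexive (e-triangle (xy , xz , yz)))
      λ { w∈ (x≢w ∷ y≢w ∷ z≢w ∷ []) → deg≤1
        ( (diamond w∈ x∈ y∈ z∈ xy xz yz z≢w ∷ diamond w∈ x∈ z∈ y∈ xz xy (~-sym yz) y≢w ∷ [])
        ∷ (diamond w∈ y∈ z∈ x∈ yz (~-sym xy) (~-sym xz) x≢w ∷ [])
        ∷ [] ∷ []) }
    where
    diamond : ∀ {w x y z} → w ∈ S → x ∈ S → y ∈ S → z ∈ S → x ~ y → x ~ z → y ~ z → ¬ z ≡ w → w ~ x → w ~ y → ⊥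
    diamond w∈ x∈ y∈ z∈ xy xz yz z≢w wx wy =
      no◇ (_ , x∈ ∷ y∈ ∷ z∈ ∷ w∈ ∷ [] , xy , xz , ~-sym wx , yz , ~-sym wy , z≢w)

  -- If `v` sees `x` and `y`, and `z`, `t` are the other two vertices of the K₄, then `x` is the
  -- centre of a fan with path `v`, `y`, `z`, `t`.
  K₄-neighbours : FanFree → ∀ {a b c d v} → IsK₄ (a ∷ b ∷ c ∷ d ∷ []) → All (λ t → ¬ t ≡ v) (a ∷ b ∷ c ∷ d ∷ []) →
    AllPairs (λ x y → v ~ x → v ~ y → ⊥) (a ∷ b ∷ c ∷ d ∷ [])
  K₄-neighbours free {v = v} (ab , ac , ad , bc , bd , cd) (a≢v ∷ b≢v ∷ c≢v ∷ d≢v ∷ []) =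
      (fan ab ac ad bc bd cd c≢v d≢v ∷ fan ac ab ad (~-sym bc) cd bd b≢v d≢v ∷ fan ad ab ac (~-sym bd) (~-sym cd) bc b≢v c≢v ∷ [])
    ∷ (fan bc (~-sym ab) bd (~-sym ac) cd ad a≢v d≢v ∷ fan bd (~-sym ab) bc (~-sym ad) (~-sym cd) ac a≢v c≢v ∷ [])
    ∷ (fan cd (~-sym ac) (~-sym bc) (~-sym ad) (~-sym bd) ab a≢v b≢v ∷ [])
    ∷ [] ∷ []
    where
    fan : ∀ {x y z t} → x ~ y → x ~ z → x ~ t → y ~ z → y ~ t → z ~ t → ¬ z ≡ v → ¬ t ≡ v → v ~ x → v ~ y → ⊥
    fan xy xz xt yz yt zt z≢v t≢v vx vy =
      free _ _ _ _ _ (~-sym vx) xy xz xt vy yz zt (z≢v ∘ ≡-sym) (t≢v ∘ ≡-sym) (~⇒≢ yt)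

  K₄-split : FanFree → ∀ {S a b c d} → Unique S → a ∈ S → b ∈ S → c ∈ S → d ∈ S →
    IsK₄ (a ∷ b ∷ c ∷ d ∷ []) → Split S (a ∷ b ∷ c ∷ d ∷ []) 6 1
  K₄-split free {S} {a} {b} {c} {d} uS a∈ b∈ c∈ d∈ K@(ab , ac , ad , bc , bd , cd) =
    split (a ∷ b ∷ c ∷ d ∷ []) uS
      ((~⇒≢ ab ∷ ~⇒≢ ac ∷ ~⇒≢ ad ∷ []) ∷ (~⇒≢ bc ∷ ~⇒≢ bd ∷ []) ∷ (~⇒≢ cd ∷ []) ∷ [] ∷ [])
      (a∈ ∷ b∈ ∷ c∈ ∷ d∈ ∷ []) (≤-reflexive (e-K₄ K))
      λ _ v∉ → deg≤1 (K₄-neighbours free K v∉)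

  diamond-split : FanFree → ∀ {S c d a b} → Unique S → ¬ Occurs IsK₄ S → c ∈ S → d ∈ S → a ∈ S → b ∈ S →
    IsDiamond (c ∷ d ∷ a ∷ b ∷ []) → Split S (c ∷ d ∷ a ∷ b ∷ []) 5 2
  diamond-split free {S} {c} {d} {a} {b} uS noK c∈ d∈ a∈ b∈ ◇@(cd , ca , cb , da , db , a≢b) =
    split (c ∷ d ∷ a ∷ b ∷ []) uS
      ((~⇒≢ cd ∷ ~⇒≢ ca ∷ ~⇒≢ cb ∷ []) ∷ (~⇒≢ da ∷ ~⇒≢ db ∷ []) ∷ (a≢b ∷ []) ∷ [] ∷ [])
      (c∈ ∷ d∈ ∷ a∈ ∷ b∈ ∷ [])
      (≤-reflexive (e-diamond ◇ (¬-not λ ab → noK (_ , c∈ ∷ d∈ ∷ a∈ ∷ b∈ ∷ [] , cd , ca , cb , da , db , ab))))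
      λ { {v} _ v∉ → proj₁ (diamond-deg free ◇ v∉) }

-- Edge bounds by induction

module _ {n : ℕ} (G : Graph n) where
  open Split

  split-≤ : ∀ {S T c d x} (s : Split G S T c d) → 4 * e G (rest s) ≤ x →
    4 * e G S ≤ 4 * c + (4 * d * length (rest s) + x)
  split-≤ {S} {T} {c} {d} {x} s rest≤ = begin
    4 * e G S                                               ≤⟨ *-monoʳ-≤ 4 (e-≤ s) ⟩
    4 * (c + (m * d + e G (rest s)))                        ≡⟨ expand c m d (e G (rest s)) ⟩
    4 * c + (4 * d * m + 4 * e G (rest s))                  ≤⟨ +-monoʳ-≤ (4 * c) (+-monoʳ-≤ (4 * d * m) rest≤) ⟩
    4 * c + (4 * d * m + x)                                 ∎
    where
    open ≤-Reasoning
    m = length (rest s)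
    expand : ∀ c m d r → 4 * (c + (m * d + r)) ≡ 4 * c + (4 * d * m + 4 * r)
    expand = solve-∀

  rest-shorter : ∀ {S t T c d k} (s : Split G S (t ∷ T) c d) → length S ≤ suc k → length (rest s) ≤ k
  rest-shorter {t = t} {T} s S≤ =
    ≤-pred (≤-trans (s≤s (m≤n+m _ (length T))) (≤-trans (≤-reflexive (≡-sym (length-S s))) S≤))

  -- Mantel's bound by deleting the two ends of an edge. The number `k` drives the recursion, as the
  -- remaining list is not a structural part of `S`.
  mantel : ∀ k S → length S ≤ k → Unique S → ¬ Occurs (IsTriangle G) S → 4 * e G S ≤ length S * length S
  mantel zero [] _ _ _ = z≤n
  mantel (suc k) S S≤ uS noΔ with occurs? (isEdge? G) S
  ... | no none rewrite e-none G S none = z≤n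
  ... | yes (u ∷ v ∷ [] , u∈ ∷ v∈ ∷ [] , u~v) = begin
    4 * e G S                          ≤⟨ split-≤ s (mantel k (rest s) (rest-shorter s S≤) (rest-unique s) (noΔ ∘ occurs-mono (rest⊆ s))) ⟩
    4 + (4 * m + m * m)                ≡⟨ square m ⟩
    (2 + m) * (2 + m)                  ≡⟨ cong (λ l → l * l) (length-S s) ⟨
    length S * length S                ∎
    where
    open ≤-Reasoning
    s = edge-split G uS noΔ u∈ v∈ u~v
    m = length (rest s)
    square : ∀ m → 4 + (4 * m + m * m) ≡ (2 + m) * (2 + m)
    square = solve-∀

  -- A diamond is deleted without loss. If there is none, deleting a triangle with m vertices left
  -- gains slack 2m, and a triangle-free graph has slack `length S` by Mantel.
  e-bound : FanFree G → ∀ k S → length S ≤ k → Unique S → ¬ Occurs (IsK₄ G) S →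
    4 * e G S ≤ length S * suc (length S)
  e-bound free zero [] _ _ _ = z≤n
  e-bound free (suc k) S S≤ uS noK with occurs? (isDiamond? G) S
  ... | yes (c ∷ d ∷ a ∷ b ∷ [] , c∈ ∷ d∈ ∷ a∈ ∷ b∈ ∷ [] , ◇) = begin
    4 * e G S                          ≤⟨ split-≤ s (e-bound free k (rest s) (rest-shorter s S≤) (rest-unique s) (noK ∘ occurs-mono (rest⊆ s))) ⟩
    20 + (8 * m + m * suc m)           ≡⟨ factor m ⟩
    (4 + m) * (5 + m)                  ≡⟨ cong (λ l → l * suc l) (length-S s) ⟨
    length S * suc (length S)          ∎
    where
    open ≤-Reasoning
    s = diamond-split G free uS noK c∈ d∈ a∈ b∈ ◇
    m = length (rest s)
    factor : ∀ m → 20 + (8 * m + m * suc m) ≡ (4 + m) * (5 + m)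
    factor = solve-∀
  ... | no no◇ with occurs? (isTriangle? G) S
  ...   | no noΔ = ≤-trans (mantel (suc k) S S≤ uS noΔ) (*-monoʳ-≤ (length S) (n≤1+n (length S)))
  ...   | yes (x ∷ y ∷ z ∷ [] , x∈ ∷ y∈ ∷ z∈ ∷ [] , Δ) = begin
    4 * e G S                          ≤⟨ split-≤ s (e-bound free k (rest s) (rest-shorter s S≤) (rest-unique s) (noK ∘ occurs-mono (rest⊆ s))) ⟩
    12 + (4 * m + m * suc m)           ≤⟨ m≤m+n _ (2 * m) ⟩
    12 + (4 * m + m * suc m) + 2 * m   ≡⟨ factor m ⟩
    (3 + m) * (4 + m)                  ≡⟨ cong (λ l → l * suc l) (length-S s) ⟨
    length S * suc (length S)          ∎
    where
    open ≤-Reasoning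
    s = triangle-split G uS no◇ x∈ y∈ z∈ Δ
    m = length (rest s)
    factor : ∀ m → 12 + (4 * m + m * suc m) + 2 * m ≡ (3 + m) * (4 + m)
    factor = solve-∀

  -- From five vertices on, the slack of both diamond-free cases reaches 4: it is at least 5 in the
  -- triangle-free case and at least 2 · 2 after deleting a triangle. This is one full edge, so a
  -- diamond is unavoidable near the bound.
  e-bound-no-diamond : FanFree G → ∀ S → 5 ≤ length S → Unique S → ¬ Occurs (IsK₄ G) S → ¬ Occurs (IsDiamond G) S →
    4 + 4 * e G S ≤ length S * suc (length S)
  e-bound-no-diamond free S 5≤S uS noK no◇ with occurs? (isTriangle? G) S
  ... | no noΔ = begin
    4 + 4 * e G S                      ≤⟨ +-mono-≤ (≤-trans (n≤1+n 4) 5≤S) (mantel _ S ≤-refl uS noΔ) ⟩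
    length S + length S * length S     ≡⟨ *-suc (length S) (length S) ⟨
    length S * suc (length S)          ∎
    where open ≤-Reasoning
  ... | yes (x ∷ y ∷ z ∷ [] , x∈ ∷ y∈ ∷ z∈ ∷ [] , Δ) = begin
    4 + 4 * e G S                      ≤⟨ +-monoʳ-≤ 4 (split-≤ s (e-bound free _ (rest s) ≤-refl (rest-unique s) (noK ∘ occurs-mono (rest⊆ s)))) ⟩
    4 + (12 + (4 * m + m * suc m))     ≤⟨ +-monoˡ-≤ (12 + (4 * m + m * suc m)) (*-monoʳ-≤ 2 2≤m) ⟩
    2 * m + (12 + (4 * m + m * suc m)) ≡⟨ factor m ⟩
    (3 + m) * (4 + m)                  ≡⟨ cong (λ l → l * suc l) (length-S s) ⟨
    length S * suc (length S)          ∎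
    where
    open ≤-Reasoning
    s = triangle-split G uS no◇ x∈ y∈ z∈ Δ
    m = length (rest s)
    2≤m : 2 ≤ m
    2≤m = +-cancelˡ-≤ 3 2 m (≤-trans 5≤S (≤-reflexive (length-S s)))
    factor : ∀ m → 2 * m + (12 + (4 * m + m * suc m)) ≡ (3 + m) * (4 + m)
    factor = solve-∀

  -- Up to two remaining vertices, the hypothesis would admit one edge too many, so the edges are
  -- counted directly. From three on it suffices, with slack 4 for each vertex beyond the third.
  K₄-excess : ∀ U → 4 * e G U ≤ 4 + length U * suc (length U) →
    24 + (4 * length U + 4 * e G U) + 4 * (length U ⊓ 2) ≤ 4 + (4 + length U) * (5 + length U)
  K₄-excess [] _ = ≤-refl
  K₄-excess (x ∷ []) _ = m≤m+n 32 2
  K₄-excess (x ∷ y ∷ []) _ with adj G x y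
  ... | true = m≤m+n 44 2
  ... | false = m≤m+n 40 6
  K₄-excess U@(_ ∷ _ ∷ _ ∷ V) U≤ = begin
    24 + (4 * (3 + m) + 4 * e G U) + 8                     ≤⟨ +-monoˡ-≤ 8 (+-monoʳ-≤ 24 (+-monoʳ-≤ (4 * (3 + m)) U≤)) ⟩
    24 + (4 * (3 + m) + (4 + (3 + m) * (4 + m))) + 8       ≤⟨ m≤m+n _ (4 * m) ⟩
    24 + (4 * (3 + m) + (4 + (3 + m) * (4 + m))) + 8 + 4 * m ≡⟨ factor m ⟩
    4 + (7 + m) * (8 + m)                                  ∎
    where
    open ≤-Reasoning
    m = length V
    factor : ∀ m → 24 + (4 * (3 + m) + (4 + (3 + m) * (4 + m))) + 8 + 4 * m ≡ 4 + (7 + m) * (8 + m)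
    factor = solve-∀

  e-bound-K₄-split : ∀ {S a b c d} (s : Split G S (a ∷ b ∷ c ∷ d ∷ []) 6 1) →
    4 * e G (rest s) ≤ 4 + length (rest s) * suc (length (rest s)) →
    4 * e G S + 4 * ((length S ∸ 4) ⊓ 2) ≤ 4 + length S * suc (length S)
  e-bound-K₄-split s rest≤ rewrite length-S s =
    ≤-trans (+-monoˡ-≤ _ (split-≤ s ≤-refl)) (K₄-excess (rest s) rest≤)

  -- The allowance of 4 pays for a K₄ on its own. It does not accumulate when several K₄ are deleted
  -- in turn, because `K₄-excess` returns the same allowance.
  e-bound-weak : FanFree G → ∀ k S → length S ≤ k → Unique S → 4 * e G S ≤ 4 + length S * suc (length S)
  e-bound-weak free zero [] _ _ = z≤n
  e-bound-weak free (suc k) S S≤ uS with occurs? (isK₄? G) S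
  ... | no noK = ≤-trans (e-bound free (suc k) S S≤ uS noK) (m≤n+m _ 4)
  ... | yes (a ∷ b ∷ c ∷ d ∷ [] , a∈ ∷ b∈ ∷ c∈ ∷ d∈ ∷ [] , K) =
    ≤-trans (m≤m+n _ _) (e-bound-K₄-split s (e-bound-weak free k (rest s) (rest-shorter s S≤) (rest-unique s)))
    where s = K₄-split G free uS a∈ b∈ c∈ d∈ K

  e-bound-K₄ : FanFree G → ∀ S → Unique S → Occurs (IsK₄ G) S →
    4 * e G S + 4 * ((length S ∸ 4) ⊓ 2) ≤ 4 + length S * suc (length S)
  e-bound-K₄ free S uS (a ∷ b ∷ c ∷ d ∷ [] , a∈ ∷ b∈ ∷ c∈ ∷ d∈ ∷ [] , K) =
    e-bound-K₄-split s (e-bound-weak free _ (rest s) ≤-refl (rest-unique s))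
    where s = K₄-split G free uS a∈ b∈ c∈ d∈ K

-- Agreement of the edge counts, and the two sides of a near-maximal graph

sum-cartesianProduct : ∀ {A B : Set} (f : A × B → ℕ) xs ys →
  sum (map f (cartesianProduct xs ys)) ≡ sum (map (λ x → sum (map (λ y → f (x , y)) ys)) xs)
sum-cartesianProduct f [] ys = refl
sum-cartesianProduct f (x ∷ xs) ys = begin
  sum (map f (map (x ,_) ys ++ cartesianProduct xs ys))
    ≡⟨ cong sum (map-++ f (map (x ,_) ys) _) ⟩
  sum (map f (map (x ,_) ys) ++ map f (cartesianProduct xs ys))
    ≡⟨ sum-++ (map f (map (x ,_) ys)) _ ⟩
  sum (map f (map (x ,_) ys)) + sum (map f (cartesianProduct xs ys))
    ≡⟨ cong₂ _+_ (cong sum (≡-sym (map-∘ ys))) (sum-cartesianProduct f xs ys) ⟩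
  sum (map (λ x → sum (map (λ y → f (x , y)) ys)) (x ∷ xs)) ∎
  where open ≡-Reasoning

<⇒<ᵇ≡true : ∀ {m n} → m < n → (m <ᵇ n) ≡ true
<⇒<ᵇ≡true (s≤s z≤n) = refl
<⇒<ᵇ≡true (s≤s (s≤s p)) = <⇒<ᵇ≡true (s≤s p)

≤⇒<ᵇ≡false : ∀ {m n} → m ≤ n → (n <ᵇ m) ≡ false
≤⇒<ᵇ≡false z≤n = refl
≤⇒<ᵇ≡false (s≤s p) = ≤⇒<ᵇ≡false p

module _ {n : ℕ} (G : Graph n) where

  -- As `allFin n` is increasing, the filter on ordered pairs in `edges` keeps each pair at its
  -- earlier entry, just as `e` does.
  edges≡e : edges G ≡ e G (allFin n)
  edges≡e = ≡-trans (sum-cartesianProduct _ (allFin n) (allFin n)) (sorted (tabulate⁺-< id))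
    where
    ordered : Fin n → Fin n → ℕ
    ordered u v = if adj G u v ∧ (toℕ u <ᵇ toℕ v) then 1 else 0
    sorted : ∀ {S} → AllPairs (λ u v → toℕ u < toℕ v) S → sum (map (λ u → sum (map (ordered u) S)) S) ≡ e G S
    sorted [] = refl
    sorted {u ∷ S} (u<S ∷ S<) rewrite irrefl G u = cong₂ _+_
      (sum-map-cong (All.map (λ {v} u<v → cong 𝟙 (≡-trans (cong (adj G u v ∧_) (<⇒<ᵇ≡true u<v)) (∧-identityʳ _))) u<S))
      (≡-trans (sum-map-cong (All.map (λ {v} u<v → cong (_+ sum (map (ordered v) S))
         (cong 𝟙 (≡-trans (cong (adj G v u ∧_) (≤⇒<ᵇ≡false (<⇒≤ u<v))) (∧-zeroʳ _)))) u<S)) (sorted S<))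

  -- The value `true` marks X. Edges between the sides are left open here; the edge count later
  -- forces all of them.
  record Sides (side : Fin n → Bool) : Set where
    field
      X-matching    : ∀ {u v w} → side u ≡ true → side v ≡ true → side w ≡ true → adj G u v ≡ true → adj G u w ≡ true → v ≡ w
      Y-independent : ∀ {u v} → side u ≡ false → side v ≡ false → adj G u v ≡ false

  open Split

  extremal-sides : FanFree G → ¬ Occurs (IsK₄ G) (allFin n) → 5 ≤ n →
    n * suc n < 4 + 4 * e G (allFin n) → ∃ Sides
  extremal-sides free noK 5≤n large with occurs? (isDiamond? G) (allFin n)
  ... | no no◇ = contradiction large (≤⇒≯ (subst (λ l → 4 + 4 * e G S ≤ l * suc l) len
          (e-bound-no-diamond G free S (subst (5 ≤_) (≡-sym len) 5≤n) (allFin⁺ n) noK no◇)))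
    where
    S = allFin n
    len = length-tabulate {n = n} id
  ... | yes (c ∷ d ∷ a ∷ b ∷ [] , c∈ ∷ d∈ ∷ a∈ ∷ b∈ ∷ [] , ◇@(cd , ca , cb , da , db , a≢b)) =
    (λ v → adj G v a) , record { X-matching = X-matching ; Y-independent = Y-independent }
    where
    open ≤-Reasoning
    S = allFin n
    len = length-tabulate {n = n} id
    infix 4 _≈_
    _≈_ = _~_ G
    s = diamond-split G free (allFin⁺ n) noK c∈ d∈ a∈ b∈ ◇
    m = length (rest s)
    b≁a : ¬ b ≈ a
    b≁a ba = noK (_ , c∈ ∷ d∈ ∷ b∈ ∷ a∈ ∷ [] , cd , cb , ca , db , da , ba)
    factor : ∀ m → 20 + (8 * m + m * suc m) ≡ (4 + m) * (5 + m)
    factor = solve-∀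
    expand : ∀ m r → 4 * (5 + (m * 2 + r)) ≡ 20 + (8 * m + 4 * r)
    expand = solve-∀
    -- One edge less than the deletion bound would already give 4 + 4e ≤ n(n + 1), against `large`.
    max : 5 + (m * 2 + e G (rest s)) ≤ e G S
    max with 5 + (m * 2 + e G (rest s)) ≤? e G S
    ... | yes max = max
    ... | no ¬max = contradiction large (≤⇒≯ (begin
      4 + 4 * e G S                          ≡⟨ *-suc 4 (e G S) ⟨
      4 * suc (e G S)                        ≤⟨ *-monoʳ-≤ 4 (≰⇒> ¬max) ⟩
      4 * (5 + (m * 2 + e G (rest s)))       ≡⟨ expand m (e G (rest s)) ⟩
      20 + (8 * m + 4 * e G (rest s))        ≤⟨ +-monoʳ-≤ 20 (+-monoʳ-≤ (8 * m)
                                                  (e-bound G free _ (rest s) ≤-refl (rest-unique s) (noK ∘ occurs-mono (rest⊆ s)))) ⟩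
      20 + (8 * m + m * suc m)               ≡⟨ factor m ⟩
      (4 + m) * (5 + m)                      ≡⟨ cong (λ l → l * suc l) (≡-trans (≡-sym (length-S s)) len) ⟩
      n * suc n                              ∎))
    -- `tight` speaks only of vertices outside the diamond, so its own four are checked separately:
    -- `c` and `d` fall into X, `a` and `b` into Y.
    side-props : ∀ v → (v ≈ a → v ≈ b) × (adj G v a ≡ false → v ≈ c × v ≈ d)
    side-props v with c ≟ v | d ≟ v | a ≟ v | b ≟ v
    ... | yes refl | _ | _ | _ = (λ _ → cb) , λ c≁a → contradiction (≡-trans (≡-sym ca) c≁a) λ ()
    ... | _ | yes refl | _ | _ = (λ _ → db) , λ d≁a → contradiction (≡-trans (≡-sym da) d≁a) λ ()
    ... | _ | _ | yes refl | _ = (λ aa → contradiction refl (~⇒≢ G aa)) , λ _ → ~-sym G ca , ~-sym G da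
    ... | _ | _ | _ | yes refl = (λ ba → contradiction ba b≁a) , λ _ → ~-sym G cb , ~-sym G db
    ... | no c≢v | no d≢v | no a≢v | no b≢v = proj₂ (diamond-deg G free ◇ v∉) (tight s max (∈-allFin v) v∉)
      where v∉ = c≢v ∷ d≢v ∷ a≢v ∷ b≢v ∷ []
    X-matching : ∀ {u v w} → u ≈ a → v ≈ a → w ≈ a → u ≈ v → u ≈ w → v ≡ w
    X-matching {u} {v} {w} ua va wa uv uw with v ≟ w
    ... | yes v≡w = v≡w
    -- The fan has centre `u` and path `v`, `a`, `w`, `b`; here `v` differs from `b` because `b` is
    -- not adjacent to `a`.
    ... | no v≢w = ⊥-elim (free _ _ _ _ _ uv ua uw (proj₁ (side-props u) ua) va (~-sym G wa) (proj₁ (side-props w) wa)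
                     v≢w (λ { refl → b≁a va }) a≢b)
    Y-independent : ∀ {u v} → adj G u a ≡ false → adj G v a ≡ false → adj G u v ≡ false
    Y-independent {u} {v} u≁a v≁a with proj₂ (side-props u) u≁a | proj₂ (side-props v) v≁a
    ... | uc , ud | vc , vd = ¬-not λ uv →
      noK (_ , ∈-allFin u ∷ ∈-allFin v ∷ c∈ ∷ d∈ ∷ [] , uv , uc , ud , vc , vd , cd)

-- Arithmetic of the class sizes

m≤n⇒∃[o]o+m≡n : ∀ {m n} → m ≤ n → ∃ λ o → o + m ≡ n
m≤n⇒∃[o]o+m≡n {m} m≤n with m≤n⇒∃[o]m+o≡n m≤n
... | o , eq = o , ≡-trans (+-comm o m) eq

-- The number of edges of E^i on i + j vertices: all pairs between the classes and a maximum
-- matching in X.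
size : ℕ → ℕ → ℕ
size i j = j * i + ⌊ i /2⌋

parity : ℕ → ℕ
parity 0 = 0
parity 1 = 1
parity (suc (suc i)) = parity i

parity-even : ∀ k → parity (k * 2) ≡ 0
parity-even zero = refl
parity-even (suc k) = parity-even k

parity-odd : ∀ k → parity (1 + k * 2) ≡ 1
parity-odd zero = refl
parity-odd (suc k) = parity-odd k

even⊎odd : ∀ i → ∃ λ k → i ≡ k * 2 ⊎ i ≡ 1 + k * 2
even⊎odd 0 = 0 , inj₁ refl
even⊎odd 1 = 0 , inj₂ refl
even⊎odd (suc (suc i)) with even⊎odd i
... | k , inj₁ refl = suc k , inj₁ refl
... | k , inj₂ refl = suc k , inj₂ refl

-- The parity term absorbs the rounding in `⌊ i /2⌋` and leaves a polynomial identity.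
4*size : ∀ i j → 4 * size i j + 2 * parity i ≡ 4 * (j * i) + 2 * i
4*size i j = ≡-trans (expand (j * i) ⌊ i /2⌋ (parity i)) (cong (4 * (j * i) +_) (halve i))
  where
  expand : ∀ x h s → 4 * (x + h) + 2 * s ≡ 4 * x + (4 * h + 2 * s)
  expand = solve-∀
  halve : ∀ i → 4 * ⌊ i /2⌋ + 2 * parity i ≡ 2 * i
  halve 0 = refl
  halve 1 = refl
  halve (suc (suc i)) = ≡-trans (step₁ ⌊ i /2⌋ (parity i)) (≡-trans (cong (4 +_) (halve i)) (step₂ i))
    where
    step₁ : ∀ h s → 4 * suc h + 2 * s ≡ 4 + (4 * h + 2 * s)
    step₁ = solve-∀
    step₂ : ∀ i → 4 + 2 * i ≡ 2 * suc (suc i)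
    step₂ = solve-∀

-- (i + j)(i + j + 1) − 4 · size i j = t² − t + 2 · parity i for t = i − j; without subtraction, this is defect-≥ if t ≥ 0
-- and, with −t in place of t, defect-≤ otherwise.
defect-≥ : ∀ j t → (t + j + j) * suc (t + j + j) + t ≡ 4 * size (t + j) j + (2 * parity (t + j) + t * t)
defect-≥ j t = ≡-trans (expand j t) (≡-trans (cong (_+ t * t) (≡-sym (4*size (t + j) j))) (+-assoc (4 * size (t + j) j) _ _))
  where
  expand : ∀ j t → (t + j + j) * suc (t + j + j) + t ≡ 4 * (j * (t + j)) + 2 * (t + j) + t * t
  expand = solve-∀

defect-≤ : ∀ i t → (i + (t + i)) * suc (i + (t + i)) ≡ 4 * size i (t + i) + (2 * parity i + (t * t + t))
defect-≤ i t = ≡-trans (expand i t) (≡-trans (cong (_+ (t * t + t)) (≡-sym (4*size i (t + i)))) (+-assoc (4 * size i (t + i)) _ _))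
  where
  expand : ∀ i t → (i + (t + i)) * suc (i + (t + i)) ≡ 4 * ((t + i) * i) + 2 * i + (t * t + t)
  expand = solve-∀

-- Since `4*size≤` bounds 4 · `size i j` by n(n + 1) for n = i + j, this says that `size i j` is n(n
-- + 1)/4 rounded down.
NearMaximal : ℕ → ℕ → Set
NearMaximal i j = (i + j) * suc (i + j) < 4 + 4 * size i j

t≤t*t : ∀ t → t ≤ t * t
t≤t*t zero = z≤n
t≤t*t t@(suc _) = m≤n*m t t

4*size≤ : ∀ i j → 4 * size i j ≤ (i + j) * suc (i + j)
4*size≤ i j with ≤-total j i
... | inj₂ i≤j with m≤n⇒∃[o]o+m≡n i≤j
...   | t , refl = ≤-trans (m≤m+n _ _) (≤-reflexive (≡-sym (defect-≤ i t)))
4*size≤ i j | inj₁ j≤i with m≤n⇒∃[o]o+m≡n j≤i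
...   | t , refl = +-cancelʳ-≤ t _ _ (begin
  4 * size (t + j) j + t                               ≤⟨ +-monoʳ-≤ (4 * size (t + j) j) (≤-trans (t≤t*t t) (m≤n+m _ _)) ⟩
  4 * size (t + j) j + (2 * parity (t + j) + t * t)    ≡⟨ defect-≥ j t ⟨
  (t + j + j) * suc (t + j + j) + t                    ∎)
  where open ≤-Reasoning

nearMaximal-≥ : ∀ j t → NearMaximal (t + j) j → 2 * parity (t + j) + t * t < 4 + t
nearMaximal-≥ j t near = +-cancelˡ-< (4 * size (t + j) j) _ _ (begin-strict
  4 * size (t + j) j + (2 * parity (t + j) + t * t)  ≡⟨ defect-≥ j t ⟨
  (t + j + j) * suc (t + j + j) + t                  <⟨ +-monoˡ-< t near ⟩
  4 + 4 * size (t + j) j + t                         ≡⟨ rearrange (4 * size (t + j) j) t ⟩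
  4 * size (t + j) j + (4 + t)                       ∎)
  where
  open ≤-Reasoning
  rearrange : ∀ x t → 4 + x + t ≡ x + (4 + t)
  rearrange = solve-∀

nearMaximal-≤ : ∀ i t → NearMaximal i (t + i) → 2 * parity i + (t * t + t) < 4
nearMaximal-≤ i t near = +-cancelˡ-< (4 * size i (t + i)) _ _ (begin-strict
  4 * size i (t + i) + (2 * parity i + (t * t + t))  ≡⟨ defect-≤ i t ⟨
  (i + (t + i)) * suc (i + (t + i))                  <⟨ near ⟩
  4 + 4 * size i (t + i)                             ≡⟨ +-comm 4 _ ⟩
  4 * size i (t + i) + 4                             ∎)
  where open ≤-Reasoning

-- The class sizes i, j of the extremal E^i_{i+j}, indexed by the residue of i + j modulo 4.
data Balanced : (r i j : ℕ) → Set where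
  [4k]    : ∀ k → Balanced 0 (k * 2) (k * 2)
  [4k+1]  : ∀ k → Balanced 1 (1 + k * 2) (k * 2)
  [4k+1]′ : ∀ k → Balanced 1 (k * 2) (1 + k * 2)
  [4k+2]  : ∀ k → Balanced 2 (1 + k * 2) (1 + k * 2)
  [4k+2]′ : ∀ k → Balanced 2 (2 + k * 2) (k * 2)
  [4k+3]  : ∀ k → Balanced 3 (2 + k * 2) (1 + k * 2)

-- The defect must stay below 4. For t = i - j ≥ 0 it is t² - t + 2 · `parity i`, so t ≤ 2, and t =
-- 2 needs i even. For t = j - i ≥ 0 it is t² + t + 2 · `parity i`, so t ≤ 1, and t = 1 needs i
-- even.
nearMaximal⇒balanced : ∀ i j → NearMaximal i j → ∃ λ r → Balanced r i j
nearMaximal⇒balanced i j near with ≤-total j i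
... | inj₁ j≤i with m≤n⇒∃[o]o+m≡n j≤i
...   | t , refl = classify t (even⊎odd j) (nearMaximal-≥ j t near)
  where
  classify : ∀ {j} t → (∃ λ k → j ≡ k * 2 ⊎ j ≡ 1 + k * 2) → 2 * parity (t + j) + t * t < 4 + t →
    ∃ λ r → Balanced r (t + j) j
  classify 0 (k , inj₁ refl) _ = _ , [4k] k
  classify 1 (k , inj₁ refl) _ = _ , [4k+1] k
  classify 2 (k , inj₁ refl) _ = _ , [4k+2]′ k
  classify 0 (k , inj₂ refl) _ = _ , [4k+2] k
  classify 1 (k , inj₂ refl) _ = _ , [4k+3] k
  classify 2 (k , inj₂ refl) lt rewrite parity-odd k = contradiction lt (<-irrefl refl)
  classify {j} t@(suc (suc (suc u))) _ lt = contradiction lt (≤⇒≯ (begin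
    4 + t                      ≤⟨ +-monoˡ-≤ t (m≤m+n 4 (2 + 2 * u)) ⟩
    6 + 2 * u + t              ≡⟨ triple u ⟩
    3 * t                      ≤⟨ *-monoˡ-≤ t (m≤m+n 3 u) ⟩
    t * t                      ≤⟨ m≤n+m _ _ ⟩
    2 * parity (t + j) + t * t ∎))
    where
    open ≤-Reasoning
    triple : ∀ u → 6 + 2 * u + (3 + u) ≡ 3 * (3 + u)
    triple = solve-∀
nearMaximal⇒balanced i j near | inj₂ i≤j with m≤n⇒∃[o]o+m≡n i≤j
...   | t , refl = classify t (even⊎odd i) (nearMaximal-≤ i t near)
  where
  classify : ∀ {i} t → (∃ λ k → i ≡ k * 2 ⊎ i ≡ 1 + k * 2) → 2 * parity i + (t * t + t) < 4 →
    ∃ λ r → Balanced r i (t + i)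
  classify 0 (k , inj₁ refl) _ = _ , [4k] k
  classify 1 (k , inj₁ refl) _ = _ , [4k+1]′ k
  classify 0 (k , inj₂ refl) _ = _ , [4k+2] k
  classify 1 (k , inj₂ refl) lt rewrite parity-odd k = contradiction lt (<-irrefl refl)
  classify {i} t@(suc (suc u)) _ lt = contradiction lt (≤⇒≯ (begin
    4                                   ≤⟨ *-mono-≤ {2} {t} {2} {t} (m≤m+n 2 u) (m≤m+n 2 u) ⟩
    t * t                               ≤⟨ m≤m+n _ t ⟩
    t * t + t                           ≤⟨ m≤n+m _ _ ⟩
    2 * parity i + (t * t + t)          ∎))
    where open ≤-Reasoning

nearMaximal-≥⁻ : ∀ j t → 2 * parity (t + j) + t * t < 4 + t → NearMaximal (t + j) j
nearMaximal-≥⁻ j t small = +-cancelʳ-< t _ _ (begin-strict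
  (t + j + j) * suc (t + j + j) + t                  ≡⟨ defect-≥ j t ⟩
  4 * size (t + j) j + (2 * parity (t + j) + t * t)  <⟨ +-monoʳ-< (4 * size (t + j) j) small ⟩
  4 * size (t + j) j + (4 + t)                       ≡⟨ rearrange (4 * size (t + j) j) t ⟩
  4 + 4 * size (t + j) j + t                         ∎)
  where
  open ≤-Reasoning
  rearrange : ∀ x t → x + (4 + t) ≡ 4 + x + t
  rearrange = solve-∀

nearMaximal-≤⁻ : ∀ i t → 2 * parity i + (t * t + t) < 4 → NearMaximal i (t + i)
nearMaximal-≤⁻ i t small = begin-strict
  (i + (t + i)) * suc (i + (t + i))                  ≡⟨ defect-≤ i t ⟩
  4 * size i (t + i) + (2 * parity i + (t * t + t))  <⟨ +-monoʳ-< (4 * size i (t + i)) small ⟩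
  4 * size i (t + i) + 4                             ≡⟨ +-comm _ 4 ⟩
  4 + 4 * size i (t + i)                             ∎
  where open ≤-Reasoning

balanced⇒nearMaximal : ∀ {r i j} → Balanced r i j → NearMaximal i j
balanced⇒nearMaximal ([4k] k) = nearMaximal-≥⁻ (k * 2) 0 (small (parity-even k))
  where
  small : ∀ {s} → s ≡ 0 → 2 * s + 0 < 4
  small refl = m≤m+n 1 3
balanced⇒nearMaximal ([4k+1] k) = nearMaximal-≥⁻ (k * 2) 1 (small (parity-odd k))
  where
  small : ∀ {s} → s ≡ 1 → 2 * s + 1 < 5
  small refl = m≤m+n 4 1
balanced⇒nearMaximal ([4k+1]′ k) = nearMaximal-≤⁻ (k * 2) 1 (small (parity-even k))
  where
  small : ∀ {s} → s ≡ 0 → 2 * s + 2 < 4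
  small refl = m≤m+n 3 1
balanced⇒nearMaximal ([4k+2] k) = nearMaximal-≥⁻ (1 + k * 2) 0 (small (parity-odd k))
  where
  small : ∀ {s} → s ≡ 1 → 2 * s + 0 < 4
  small refl = m≤m+n 3 1
balanced⇒nearMaximal ([4k+2]′ k) = nearMaximal-≥⁻ (k * 2) 2 (small (parity-even k))
  where
  small : ∀ {s} → s ≡ 0 → 2 * s + 4 < 6
  small refl = m≤m+n 5 1
balanced⇒nearMaximal ([4k+3] k) = nearMaximal-≥⁻ (1 + k * 2) 1 (small (parity-even k))
  where
  small : ∀ {s} → s ≡ 0 → 2 * s + 1 < 5
  small refl = m≤m+n 2 3

-- Class sizes by residue modulo 4

⌊k*4/2⌋ : ∀ k → ⌊ k * 4 /2⌋ ≡ k * 2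
⌊k*4/2⌋ zero = refl
⌊k*4/2⌋ (suc k) = cong (2 +_) (⌊k*4/2⌋ k)

⌈k*4/2⌉ : ∀ k → ⌈ k * 4 /2⌉ ≡ k * 2
⌈k*4/2⌉ zero = refl
⌈k*4/2⌉ (suc k) = cong (2 +_) (⌈k*4/2⌉ k)

k*2+k*2 : ∀ k → k * 2 + k * 2 ≡ k * 4
k*2+k*2 = solve-∀

k*2+[1+k*2] : ∀ k → k * 2 + (1 + k * 2) ≡ 1 + k * 4
k*2+[1+k*2] = solve-∀

ExtremalSize : (r n i : ℕ) → Set
ExtremalSize 1 n i = i ≡ ⌈ n /2⌉ ⊎ i ≡ ⌊ n /2⌋
ExtremalSize 2 n i = i ≡ ⌊ n /2⌋ ⊎ i ≡ ⌊ n /2⌋ + 1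
ExtremalSize _ n i = i ≡ ⌈ n /2⌉

balanced⇒extremalSize : ∀ {r i j} → Balanced r i j → (i + j) % 4 ≡ r × ExtremalSize r (i + j) i
balanced⇒extremalSize ([4k] k) rewrite k*2+k*2 k = [m+kn]%n≡m%n 0 k 4 , ≡-sym (⌈k*4/2⌉ k)
balanced⇒extremalSize ([4k+1] k) rewrite k*2+k*2 k = [m+kn]%n≡m%n 1 k 4 , inj₁ (cong suc (≡-sym (⌊k*4/2⌋ k)))
balanced⇒extremalSize ([4k+1]′ k) rewrite k*2+[1+k*2] k = [m+kn]%n≡m%n 1 k 4 , inj₂ (≡-sym (⌈k*4/2⌉ k))
balanced⇒extremalSize ([4k+2] k) rewrite k*2+[1+k*2] k = [m+kn]%n≡m%n 2 k 4 , inj₁ (cong suc (≡-sym (⌊k*4/2⌋ k)))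
balanced⇒extremalSize ([4k+2]′ k) rewrite k*2+k*2 k =
  [m+kn]%n≡m%n 2 k 4 , inj₂ (≡-trans (cong (2 +_) (≡-sym (⌊k*4/2⌋ k))) (+-comm 1 _))
balanced⇒extremalSize ([4k+3] k) rewrite k*2+[1+k*2] k = [m+kn]%n≡m%n 3 k 4 , cong (2 +_) (≡-sym (⌊k*4/2⌋ k))

extremalSize⇒balanced : ∀ {r n i} → n % 4 ≡ r → ExtremalSize r n i → ∃ λ j → Balanced r i j × i + j ≡ n
-- Rewriting `n` as its remainder plus four times its quotient `k` makes the rounded halves
-- explicit; the bound on the remainder dismisses `r` beyond 3.
extremalSize⇒balanced {r} {n} n%4≡r size with n % 4 | n / 4 | m≡m%n+[m/n]*n n 4 | m%n<n n 4
extremalSize⇒balanced {0} refl refl | _ | k | refl | _ rewrite ⌈k*4/2⌉ k = _ , [4k] k , k*2+k*2 k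
extremalSize⇒balanced {1} refl (inj₁ refl) | _ | k | refl | _ rewrite ⌊k*4/2⌋ k = _ , [4k+1] k , cong suc (k*2+k*2 k)
extremalSize⇒balanced {1} refl (inj₂ refl) | _ | k | refl | _ rewrite ⌈k*4/2⌉ k = _ , [4k+1]′ k , k*2+[1+k*2] k
extremalSize⇒balanced {2} refl (inj₁ refl) | _ | k | refl | _ rewrite ⌊k*4/2⌋ k = _ , [4k+2] k , cong suc (k*2+[1+k*2] k)
extremalSize⇒balanced {2} refl (inj₂ refl) | _ | k | refl | _ rewrite ⌊k*4/2⌋ k | +-comm (k * 2) 1 = _ , [4k+2]′ k , cong (2 +_) (k*2+k*2 k)
extremalSize⇒balanced {3} refl refl | _ | k | refl | _ rewrite ⌊k*4/2⌋ k = _ , [4k+3] k , cong (2 +_) (k*2+[1+k*2] k)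
extremalSize⇒balanced {suc (suc (suc (suc _)))} refl _ | _ | _ | _ | s≤s (s≤s (s≤s (s≤s ())))

-- Fans against P²₅, and fan-freeness of E^i

module _ {n : ℕ} {G : Graph n} where

  open Sides
  private
    infix 4 _≈_
    _≈_ = _~_ G

  -- If the centre is in Y, the whole path is in X and `q` has two neighbours there. If the centre
  -- is in X, each of the disjoint path edges `pq` and `rs` has an end in X, so the centre has two
  -- neighbours in X.
  sides⇒fanFree : ∀ {side} → Sides G side → FanFree G
  sides⇒fanFree {side} sides c p q r s cp cq cr cs pq qr rs p≢r p≢s q≢s with side c in c∈
  ... | false = p≢r (X-matching sides (X cq) (X cp) (X cr) (~-sym G pq) qr)
    where
    X : ∀ {v} → c ≈ v → side v ≡ true
    X {v} cv with side v in v∈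
    ... | true = refl
    ... | false = contradiction (≡-trans (≡-sym (Y-independent sides c∈ v∈)) cv) λ ()
  ... | true with X-end pq | X-end rs
    where
    X-end : ∀ {u v} → u ≈ v → side u ≡ true ⊎ side v ≡ true
    X-end {u} {v} uv with side u in u∈ | side v in v∈
    ... | true | _ = inj₁ refl
    ... | false | true = inj₂ refl
    ... | false | false = contradiction (≡-trans (≡-sym (Y-independent sides u∈ v∈)) uv) λ ()
  ...   | inj₁ p∈ | inj₁ r∈ = p≢r (X-matching sides c∈ p∈ r∈ cp cr)
  ...   | inj₁ p∈ | inj₂ s∈ = p≢s (X-matching sides c∈ p∈ s∈ cp cs)
  ...   | inj₂ q∈ | inj₁ r∈ = ~⇒≢ G qr (X-matching sides c∈ q∈ r∈ cq cr)
  ...   | inj₂ q∈ | inj₂ s∈ = q≢s (X-matching sides c∈ q∈ s∈ cq cs)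

  fanFree⇒P²₅-free : FanFree G → P²₅-free G
  fanFree⇒P²₅-free free (f , f-inj , hom) =
    free _ _ _ _ _ (hom v₃ v₁ refl) (hom v₃ v₂ refl) (hom v₃ v₄ refl) (hom v₃ v₅ refl)
      (hom v₁ v₂ refl) (hom v₂ v₄ refl) (hom v₄ v₅ refl)
      (λ eq → contradiction (f-inj eq) λ ()) (λ eq → contradiction (f-inj eq) λ ()) (λ eq → contradiction (f-inj eq) λ ())
    where
    v₁ v₂ v₃ v₄ v₅ : Fin 5
    v₁ = zero
    v₂ = suc zero
    v₃ = suc (suc zero)
    v₄ = suc (suc (suc zero))
    v₅ = suc (suc (suc (suc zero)))

  P²₅-free⇒fanFree : P²₅-free G → FanFree G
  P²₅-free⇒fanFree free c p q r s cp cq cr cs pq qr rs p≢r p≢s q≢s = free (lookup S , lookup-injective uS , hom)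
    where
    -- The centre takes the middle position, the only one within distance two of all others.
    S = p ∷ q ∷ c ∷ r ∷ s ∷ []
    uS : Unique S
    uS = (~⇒≢ G pq ∷ ~⇒≢ G (~-sym G cp) ∷ p≢r ∷ p≢s ∷ []) ∷ (~⇒≢ G (~-sym G cq) ∷ ~⇒≢ G qr ∷ q≢s ∷ [])
       ∷ (~⇒≢ G cr ∷ ~⇒≢ G cs ∷ []) ∷ (~⇒≢ G rs ∷ []) ∷ [] ∷ []
    forward : ∀ i j → toℕ i < toℕ j → adj (P² 5) i j ≡ true → lookup S i ≈ lookup S j
    forward zero (suc zero) _ _ = pq
    forward zero (suc (suc zero)) _ _ = ~-sym G cp
    forward (suc zero) (suc (suc zero)) _ _ = ~-sym G cq
    forward (suc zero) (suc (suc (suc zero))) _ _ = qr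
    forward (suc (suc zero)) (suc (suc (suc zero))) _ _ = cr
    forward (suc (suc zero)) (suc (suc (suc (suc zero)))) _ _ = cs
    forward (suc (suc (suc zero))) (suc (suc (suc (suc zero)))) _ _ = rs
    forward (suc (suc zero)) (suc zero) (s≤s ()) _
    forward (suc (suc (suc _))) (suc zero) (s≤s ()) _
    forward (suc (suc (suc _))) (suc (suc zero)) (s≤s (s≤s ())) _
    forward (suc (suc (suc _))) (suc (suc (suc zero))) (s≤s (s≤s (s≤s ()))) _
    forward (suc (suc (suc (suc zero)))) (suc (suc (suc (suc zero)))) (s≤s (s≤s (s≤s (s≤s ())))) _
    hom : ∀ i j → adj (P² 5) i j ≡ true → lookup S i ≈ lookup S j
    hom i j ij with <-cmp (toℕ i) (toℕ j)
    ... | tri< i<j _ _ = forward i j i<j ij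
    ... | tri≈ _ i≡j _ = contradiction (toℕ-injective i≡j) (~⇒≢ (P² 5) {i} {j} ij)
    ... | tri> _ _ j<i = ~-sym G (forward j i j<i (~-sym (P² 5) {i} {j} ij))

partner-unique : ∀ u v w → ⌊ u /2⌋ ≡ ⌊ v /2⌋ → ⌊ u /2⌋ ≡ ⌊ w /2⌋ → ¬ u ≡ v → ¬ u ≡ w → v ≡ w
partner-unique 0 0 w _ _ u≢v _ = contradiction refl u≢v
partner-unique 0 1 0 _ _ _ u≢w = contradiction refl u≢w
partner-unique 0 1 1 _ _ _ _ = refl
partner-unique 1 1 w _ _ u≢v _ = contradiction refl u≢v
partner-unique 1 0 1 _ _ _ u≢w = contradiction refl u≢w
partner-unique 1 0 0 _ _ _ _ = refl
partner-unique (suc (suc u)) (suc (suc v)) (suc (suc w)) uv uw u≢v u≢w =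
  cong (2 +_) (partner-unique u v w (cong pred uv) (cong pred uw) (u≢v ∘ cong (2 +_)) (u≢w ∘ cong (2 +_)))

E-side : ∀ {n} → ℕ → Fin n → Bool
E-side i v = toℕ v <ᵇ i

E-sides : ∀ n i → Sides (E n i) (E-side i)
E-sides n i = record { X-matching = X-matching ; Y-independent = Y-independent }
  where
  Y-independent : ∀ {u v} → E-side i u ≡ false → E-side i v ≡ false → adj (E n i) u v ≡ false
  Y-independent u∉ v∉ rewrite u∉ | v∉ = refl
  partners : ∀ {u v} → E-side i u ≡ true → E-side i v ≡ true → adj (E n i) u v ≡ true → ⌊ toℕ u /2⌋ ≡ ⌊ toℕ v /2⌋
  partners {u} {v} u∈ v∈ uv
    rewrite u∈ | v∈ | ≡ᵇ-sym ⌊ toℕ v /2⌋ ⌊ toℕ u /2⌋ | ∨-idem (⌊ toℕ u /2⌋ ≡ᵇ ⌊ toℕ v /2⌋)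
    with ⌊ toℕ u /2⌋ ≡ᵇ ⌊ toℕ v /2⌋ in eq
  ... | true = ≡ᵇ⇒≡ _ _ (subst T (≡-sym eq) _)
  X-matching : ∀ {u v w} → E-side i u ≡ true → E-side i v ≡ true → E-side i w ≡ true →
    adj (E n i) u v ≡ true → adj (E n i) u w ≡ true → v ≡ w
  X-matching {u} {v} {w} u∈ v∈ w∈ uv uw = toℕ-injective (partner-unique (toℕ u) (toℕ v) (toℕ w)
    (partners {u} {v} u∈ v∈ uv) (partners {u} {w} u∈ w∈ uw)
    (~⇒≢ (E n i) {u} {v} uv ∘ toℕ-injective) (~⇒≢ (E n i) {u} {w} uw ∘ toℕ-injective))

-- Counting the edges of E^i

deg-map : ∀ {m n} (G : Graph m) (H : Graph n) (f : Fin m → Fin n) → (∀ u v → adj G u v ≡ adj H (f u) (f v)) →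
  ∀ v S → deg G v S ≡ deg H (f v) (map f S)
deg-map G H f pres v S = ≡-trans (sum-map-cong {xs = S} (All.universal (λ w → cong 𝟙 (pres v w)) S)) (cong sum (map-∘ S))

e-map : ∀ {m n} (G : Graph m) (H : Graph n) (f : Fin m → Fin n) → (∀ u v → adj G u v ≡ adj H (f u) (f v)) →
  ∀ S → e G S ≡ e H (map f S)
e-map G H f pres [] = refl
e-map G H f pres (v ∷ S) = cong₂ _+_ (deg-map G H f pres v S) (e-map G H f pres S)

e-tabulate : ∀ {m n} (G : Graph m) (H : Graph n) (f : Fin m → Fin n) → (∀ u v → adj G u v ≡ adj H (f u) (f v)) →
  e H (tabulate f) ≡ e G (allFin m)
e-tabulate G H f pres = ≡-trans (cong (e H) (≡-sym (map-tabulate id f))) (≡-sym (e-map G H f pres (allFin _)))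

sum-tabulate-const : ∀ {n} (f : Fin n → ℕ) k → (∀ v → f v ≡ k) → sum (tabulate f) ≡ n * k
sum-tabulate-const {zero} f k f≡ = refl
sum-tabulate-const {suc n} f k f≡ = cong₂ _+_ (f≡ zero) (sum-tabulate-const (f ∘ suc) k (f≡ ∘ suc))

count-Y : ∀ i j → sum (tabulate {n = i + j} (λ v → 𝟙 (not (E-side i v)))) ≡ j
count-Y zero j = ≡-trans (sum-tabulate-const {j} (λ _ → 1) 1 (λ _ → refl)) (*-identityʳ j)
count-Y (suc i) j = count-Y i j

deg-tabulate : ∀ {m n} (G : Graph n) v (f : Fin m → Fin n) → deg G v (tabulate f) ≡ sum (tabulate (λ w → 𝟙 (adj G v (f w))))
deg-tabulate G v f = cong sum (map-tabulate f _)

-- Removing the first matched pair of X leaves E^i on the other vertices by computation, since `<ᵇ`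
-- and `⌊_/2⌋` both shift with the index. Each vertex of the pair sees exactly Y outside the pair.
e-E : ∀ i j → e (E (i + j) i) (allFin (i + j)) ≡ size i j
e-E zero j = ≡-trans (e-none (E j 0) (allFin j) λ { (_ ∷ _ ∷ [] , _ , ()) }) (≡-sym (cong (_+ 0) (*-zeroʳ j)))
e-E (suc zero) j = cong₂ _+_
  (≡-trans (deg-tabulate (E (1 + j) 1) zero suc) (sum-tabulate-const {j} _ 1 (λ _ → refl)))
  (≡-trans (e-tabulate (E j 0) (E (1 + j) 1) suc (λ _ _ → refl)) (≡-trans (e-E zero j) (cong (_+ 0) (*-zeroʳ j))))
e-E (suc (suc i)) j = begin
  suc (deg E₂ zero (tabulate suc²)) + (deg E₂ (suc zero) (tabulate suc²) + e E₂ (tabulate suc²))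
    ≡⟨ cong₂ _+_ (cong suc (deg-X zero join₀)) (cong₂ _+_ (deg-X (suc zero) join₁) (≡-trans (e-tabulate (E (i + j) i) E₂ suc² (λ _ _ → refl)) (e-E i j))) ⟩
  suc j + (j + size i j)
    ≡⟨ expand i j ⌊ i /2⌋ ⟩
  size (2 + i) j ∎
  where
  open ≡-Reasoning
  suc² : Fin (i + j) → Fin (2 + (i + j))
  suc² v = suc (suc v)
  E₂ = E (2 + (i + j)) (2 + i)
  join₀ : ∀ w → adj E₂ zero (suc (suc w)) ≡ not (E-side i w)
  join₀ w with E-side i w
  ... | true = refl
  ... | false = refl
  join₁ : ∀ w → adj E₂ (suc zero) (suc (suc w)) ≡ not (E-side i w)
  join₁ w with E-side i w
  ... | true = refl
  ... | false = refl
  deg-X : ∀ x → (∀ w → adj E₂ x (suc (suc w)) ≡ not (E-side i w)) → deg E₂ x (tabulate suc²) ≡ j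
  deg-X x join = ≡-trans (deg-tabulate E₂ x suc²) (≡-trans (cong sum (tabulate-cong (cong 𝟙 ∘ join))) (count-Y i j))
  expand : ∀ i j h → suc j + (j + (j * i + h)) ≡ j * (2 + i) + suc h
  expand = solve-∀

-- Permutations of the vertices and isomorphisms

allFin↭ : ∀ {n} {S : List (Fin n)} → Unique S → length S ≡ n → allFin n ↭ S
allFin↭ {n} {S} uS len with extract {xs = allFin n} uS (All.universal ∈-allFin S)
... | [] , p = subst (allFin n ↭_) (++-identityʳ S) p
... | y ∷ ys , p = contradiction (begin
  length S                     ≡⟨ ≡-trans len (≡-sym (length-tabulate id)) ⟩
  length (allFin n)            ≡⟨ ≡-trans (↭-length p) (length-++ S) ⟩
  length S + suc (length ys)   ∎) (m≢1+m+n (length S) ∘ λ eq → ≡-trans eq (+-suc (length S) _))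
  where open ≡-Reasoning

map-allFin↭ : ∀ {n} (f : Fin n → Fin n) → Injective _≡_ _≡_ f → allFin n ↭ map f (allFin n)
map-allFin↭ f f-inj = allFin↭ (Unique-map⁺ f-inj (allFin⁺ _)) (≡-trans (length-map f (allFin _)) (length-tabulate id))

-- An injective self-map of `Fin n` permutes it. The map goes from `H` to `G` because it arises by
-- listing the vertices of `G` in the order of the model `H`.
injective⇒≅ : ∀ {n} {G H : Graph n} (f : Fin n → Fin n) → Injective _≡_ _≡_ f →
  (∀ p q → adj H p q ≡ adj G (f p) (f q)) → G ≅ H
injective⇒≅ {n} {G} {H} f f-inj pres = record
  { to = f⁻¹
  ; from = f
  ; from∘to = f∘f⁻¹
  ; to∘from = λ p → f-inj (f∘f⁻¹ (f p))
  ; pres = λ u v → ≡-trans (≡-sym (cong₂ (adj G) (f∘f⁻¹ u) (f∘f⁻¹ v))) (≡-sym (pres (f⁻¹ u) (f⁻¹ v)))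
  }
  where
  preimage : ∀ v → ∃ λ p → v ≡ f p
  preimage v with ∈-map⁻ f (∈-resp-↭ (map-allFin↭ f f-inj) (∈-allFin v))
  ... | p , _ , v≡fp = p , v≡fp
  f⁻¹ : Fin n → Fin n
  f⁻¹ v = proj₁ (preimage v)
  f∘f⁻¹ : ∀ v → f (f⁻¹ v) ≡ v
  f∘f⁻¹ v = ≡-sym (proj₂ (preimage v))

symmetric-ext : ∀ {m n} (H : Graph m) (G : Graph n) (f : Fin m → Fin n) →
  (∀ p q → toℕ p < toℕ q → adj H p q ≡ adj G (f p) (f q)) → ∀ p q → adj H p q ≡ adj G (f p) (f q)
symmetric-ext H G f forward p q with <-cmp (toℕ p) (toℕ q)
... | tri< p<q _ _ = forward p q p<q
... | tri≈ _ p≡q _ rewrite toℕ-injective p≡q = ≡-trans (irrefl H q) (≡-sym (irrefl G (f q)))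
... | tri> _ _ q<p = ≡-trans (sym H p q) (≡-trans (forward q p q<p) (sym G (f q) (f p)))

𝟙≤1 : ∀ b → 𝟙 b ≤ 1
𝟙≤1 true = ≤-refl
𝟙≤1 false = z≤n

𝟙≡1 : ∀ {b} → 𝟙 b ≡ 1 → b ≡ true
𝟙≡1 {true} _ = refl

⌊k*2/2⌋ : ∀ k → ⌊ k * 2 /2⌋ ≡ k
⌊k*2/2⌋ zero = refl
⌊k*2/2⌋ (suc k) = cong suc (⌊k*2/2⌋ k)

n≤1+⌊n/2⌋*2 : ∀ n → n ≤ 1 + ⌊ n /2⌋ * 2
n≤1+⌊n/2⌋*2 0 = z≤n
n≤1+⌊n/2⌋*2 1 = ≤-refl
n≤1+⌊n/2⌋*2 (suc (suc n)) = s≤s (s≤s (n≤1+⌊n/2⌋*2 n))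

module _ {n : ℕ} {G H : Graph n} (G≅H : G ≅ H) where
  open _≅_ G≅H

  to-injective : Injective _≡_ _≡_ to
  to-injective {u} {v} eq = ≡-trans (≡-sym (from∘to u)) (≡-trans (cong from eq) (from∘to v))

  e-≅ : e G (allFin n) ≡ e H (allFin n)
  e-≅ = ≡-trans (e-map G H to pres (allFin n)) (≡-sym (e-↭ H (map-allFin↭ to to-injective)))

  fanFree-≅ : FanFree H → FanFree G
  fanFree-≅ free _ _ _ _ _ cp cq cr cs pq qr rs p≢r p≢s q≢s =
    free _ _ _ _ _ (to~ cp) (to~ cq) (to~ cr) (to~ cs) (to~ pq) (to~ qr) (to~ rs)
      (p≢r ∘ to-injective) (p≢s ∘ to-injective) (q≢s ∘ to-injective)
    where
    to~ : ∀ {u v} → _~_ G u v → _~_ H (to u) (to v)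
    to~ {u} {v} uv = ≡-trans (≡-sym (pres u v)) uv

-- From two sides to E^i

module _ {n : ℕ} (G : Graph n) {side : Fin n → Bool} (sides : Sides G side) where

  open Sides sides
  private
    infix 4 _≈_
    _≈_ = _~_ G

  -- A normal form for X: `p` edges isolated within the list, then an independent remainder.
  data Paired : ℕ → List (Fin n) → Set where
    independent : ∀ {L} → ¬ Occurs (IsEdge G) L → Paired 0 L
    pair : ∀ {p x y L} → x ≈ y → All (λ v → adj G x v ≡ false) L → All (λ v → adj G y v ≡ false) L →
      Paired p L → Paired (suc p) (x ∷ y ∷ L)

  -- Edges are picked greedily; by `X-matching` the ends of a picked edge have no further neighbour
  -- in the list.
  pair-up : ∀ k S → length S ≤ k → Unique S → All (λ v → side v ≡ true) S → ∃₂ λ p L → S ↭ L × Paired p L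
  pair-up zero [] _ _ _ = 0 , [] , refl , independent λ { (_ ∷ _ ∷ [] , () ∷ _ , _) }
  pair-up (suc k) S S≤ uS S⊆X with occurs? (isEdge? G) S
  ... | no none = 0 , S , refl , independent none
  ... | yes (x ∷ y ∷ [] , x∈ ∷ y∈ ∷ [] , xy) with extract ((~⇒≢ G xy ∷ []) ∷ [] ∷ []) (x∈ ∷ y∈ ∷ [])
  ...   | U , σ with Unique-resp-↭ σ uS | All-resp-↭ σ S⊆X
  ...     | (_ ∷ x≢U) ∷ y≢U ∷ uU | xX ∷ yX ∷ U⊆X
    with pair-up k U (≤-pred (≤-trans (n≤1+n _) (≤-trans (≤-reflexive (≡-sym (↭-length σ))) S≤))) uU U⊆X
  ...       | p , L , τ , paired =
    suc p , x ∷ y ∷ L , trans σ (prep x (prep y τ)) , pair xy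
      (All-resp-↭ τ (All.zipWith (λ (y≢v , vX) → ¬-not λ xv → y≢v (X-matching xX yX vX xy xv)) (y≢U , U⊆X)))
      (All-resp-↭ τ (All.zipWith (λ (x≢v , vX) → ¬-not λ yv → x≢v (X-matching yX xX vX (~-sym G xy) yv)) (x≢U , U⊆X)))
      paired

  e-paired : ∀ {p L} → Paired p L → e G L ≡ p
  e-paired {L = L} (independent none) = e-none G L none
  e-paired (pair xy x≁L y≁L paired) rewrite xy | deg-none G x≁L | deg-none G y≁L | e-paired paired = refl

  paired-length : ∀ {p L} → Paired p L → p * 2 ≤ length L
  paired-length (independent _) = z≤n
  paired-length (pair _ _ _ paired) = s≤s (s≤s (paired-length paired))

  -- The vertices in the order in which `E` numbers them: matched pairs of X at positions 2t and 2t
  -- + 1, at most one unmatched vertex of X, then Y.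
  data Layout : ℕ → List (Fin n) → Set where
    independent : ∀ {L} → All (λ v → side v ≡ false) L → Layout 0 L
    single : ∀ {x L} → side x ≡ true → All (λ v → adj G x v ≡ true) L → Layout 0 L → Layout 1 (x ∷ L)
    pair : ∀ {i x y L} → side x ≡ true → side y ≡ true → x ≈ y →
      All (λ v → adj G x v ≡ not (side v)) L → All (λ v → adj G y v ≡ not (side v)) L →
      Layout i L → Layout (2 + i) (x ∷ y ∷ L)

  layout-side : ∀ {i L} → Layout i L → ∀ q → side (lookup L q) ≡ (toℕ q <ᵇ i)
  layout-side (independent L⊆Y) q = All.lookup L⊆Y (∈-lookup q)
  layout-side (single xX _ _) zero = xX
  layout-side (single _ _ layout) (suc q) = layout-side layout q
  layout-side (pair xX _ _ _ _ _) zero = xX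
  layout-side (pair _ yX _ _ _ _) (suc zero) = yX
  layout-side (pair _ _ _ _ _ layout) (suc (suc q)) = layout-side layout q

  layout-adj : ∀ {i L} → Layout i L → ∀ p q → toℕ p < toℕ q →
    adj (E (length L) i) p q ≡ adj G (lookup L p) (lookup L q)
  layout-adj (independent L⊆Y) p q _ = ≡-sym (Y-independent (All.lookup L⊆Y (∈-lookup p)) (All.lookup L⊆Y (∈-lookup q)))
  layout-adj (single _ x~L _) zero (suc q) _ = ≡-sym (All.lookup x~L (∈-lookup q))
  layout-adj (single _ _ layout) (suc p) (suc q) (s≤s p<q) = layout-adj layout p q p<q
  layout-adj (pair _ _ xy _ _ _) zero (suc zero) _ = ≡-sym xy
  layout-adj {suc (suc i)} (pair _ _ _ x~Y _ layout) zero (suc (suc q)) _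
    rewrite All.lookup x~Y (∈-lookup q) | layout-side layout q with toℕ q <ᵇ i
  ... | true = refl
  ... | false = refl
  layout-adj {suc (suc i)} (pair _ _ _ _ y~Y layout) (suc zero) (suc (suc q)) _
    rewrite All.lookup y~Y (∈-lookup q) | layout-side layout q with toℕ q <ᵇ i
  ... | true = refl
  ... | false = refl
  layout-adj (pair _ _ _ _ _ layout) (suc (suc p)) (suc (suc q)) (s≤s (s≤s p<q)) = layout-adj layout p q p<q
  layout-adj (pair _ _ _ _ _ _) (suc _) (suc zero) (s≤s ())

  -- The length bound says that the matching misses at most one vertex of X, which is then the
  -- `single` entry.
  paired⇒layout : ∀ {p L Y} → Paired p L → length L ≤ 1 + p * 2 →
    All (λ v → side v ≡ true) L → All (λ v → side v ≡ false) Y → All (λ x → All (λ v → adj G x v ≡ true) Y) L →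
    Layout (length L) (L ++ Y)
  paired⇒layout {L = []} (independent _) _ _ Y⊆Y _ = independent Y⊆Y
  paired⇒layout {L = _ ∷ []} (independent _) _ (xX ∷ []) Y⊆Y (x~Y ∷ []) = single xX x~Y (independent Y⊆Y)
  paired⇒layout {L = _ ∷ _ ∷ _} (independent _) (s≤s ()) _ _ _
  paired⇒layout {Y = Y} (pair {x = x} {y} {L} xy x≁L y≁L paired) (s≤s (s≤s L≤)) (xX ∷ yX ∷ L⊆X) Y⊆Y (x~Y ∷ y~Y ∷ L~Y) =
    pair xX yX xy (joined x x≁L x~Y) (joined y y≁L y~Y) (paired⇒layout paired L≤ L⊆X Y⊆Y L~Y)
    where
    joined : ∀ x → All (λ v → adj G x v ≡ false) L → All (λ v → adj G x v ≡ true) Y →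
      All (λ v → adj G x v ≡ not (side v)) (L ++ Y)
    joined x x≁L x~Y = ++⁺
      (All.zipWith (λ (x≁v , vX) → ≡-trans x≁v (cong not (≡-sym vX))) (x≁L , L⊆X))
      (All.zipWith (λ (xv , vY) → ≡-trans xv (cong not (≡-sym vY))) (x~Y , Y⊆Y))

  split-sides : ∀ S → ∃₂ λ X Y → S ↭ X ++ Y × All (λ v → side v ≡ true) X × All (λ v → side v ≡ false) Y
  split-sides [] = [] , [] , refl , [] , []
  split-sides (v ∷ S) with split-sides S | side v in v∈
  ... | X , Y , σ , X⊆ , Y⊆ | true = v ∷ X , Y , prep v σ , v∈ ∷ X⊆ , Y⊆
  ... | X , Y , σ , X⊆ , Y⊆ | false = X , v ∷ Y , trans (prep v σ) (↭-sym (shift v X Y)) , X⊆ , v∈ ∷ Y⊆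

  layout⇒≅ : ∀ {i S} → Unique S → length S ≡ n → Layout i S → G ≅ E n i
  layout⇒≅ {i} {S} uS len layout = injective⇒≅ f (cast-injective ∘ lookup-injective uS) pres
    where
    index : Fin n → Fin (length S)
    index = cast (≡-sym len)
    cast-injective : ∀ {p q} → index p ≡ index q → p ≡ q
    cast-injective {p} {q} eq = toℕ-injective
      (≡-trans (≡-sym (toℕ-cast (≡-sym len) p)) (≡-trans (cong toℕ eq) (toℕ-cast (≡-sym len) q)))
    f : Fin n → Fin n
    f = lookup S ∘ index
    forward : ∀ p q → toℕ p < toℕ q → adj (E n i) p q ≡ adj G (f p) (f q)
    forward p q p<q with layout-adj layout (index p) (index q)
    ... | indexed rewrite toℕ-cast (≡-sym len) p | toℕ-cast (≡-sym len) q = indexed p<q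
    pres : ∀ p q → adj (E n i) p q ≡ adj G (f p) (f q)
    pres = symmetric-ext (E n i) G f forward

  -- The count is e = p + `cross` with p ≤ ⌊i/2⌋ and `cross` ≤ j · i, hence at most `size i j`. The
  -- threshold gives the reverse inequality, so both summands are maximal.
  sides⇒≅E : n * suc n < 4 + 4 * e G (allFin n) → ∃₂ λ i j → i + j ≡ n × NearMaximal i j × G ≅ E n i
  sides⇒≅E large with split-sides (allFin n)
  ... | X , Y , σ , X⊆ , Y⊆
    with pair-up _ X ≤-refl (proj₁ (Unique-++⁻ Y (Unique-resp-↭ (↭-trans σ (++-comm X Y)) (allFin⁺ n)))) X⊆
  ...   | p , L , τ , paired = i , j , i+j≡n , near , layout⇒≅ uS len layout
    where
    open ≤-Reasoning
    i = length L
    j = length Y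
    ρ : allFin n ↭ L ++ Y
    ρ = ↭-trans σ (++⁺ʳ Y τ)
    uS : Unique (L ++ Y)
    uS = Unique-resp-↭ ρ (allFin⁺ n)
    len : length (L ++ Y) ≡ n
    len = ≡-trans (≡-sym (↭-length ρ)) (length-tabulate id)
    i+j≡n : i + j ≡ n
    i+j≡n = ≡-trans (≡-sym (length-++ L)) len
    cross = sum (map (λ v → deg G v L) Y)
    e≡ : e G (allFin n) ≡ p + cross
    e≡ = ≡-trans (≡-trans (e-↭ G ρ) (e-++ G L Y)) (cong₂ _+_ (e-paired paired)
      (≡-trans (cong (cross +_) (e-none G Y λ { (_ ∷ _ ∷ [] , u∈ ∷ v∈ ∷ [] , uv) →
        contradiction (≡-trans (≡-sym (Y-independent (All.lookup Y⊆ u∈) (All.lookup Y⊆ v∈))) uv) λ () })) (+-identityʳ cross)))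
    deg≤ : All (λ v → deg G v L ≤ i) Y
    deg≤ = All.universal (λ v → ≤-trans (sum-map-≤ {k = 1} (All.universal (λ w → 𝟙≤1 (adj G v w)) L)) (≤-reflexive (*-identityʳ i))) Y
    cross≤ : cross ≤ j * i
    cross≤ = sum-map-≤ deg≤
    p≤ : p ≤ ⌊ i /2⌋
    p≤ = ≤-trans (≤-reflexive (≡-sym (⌊k*2/2⌋ p))) (⌊n/2⌋-mono (paired-length paired))
    large′ : (i + j) * suc (i + j) < 4 + 4 * (p + cross)
    large′ = subst₂ (λ m x → m * suc m < 4 + 4 * x) (≡-sym i+j≡n) e≡ large
    near : NearMaximal i j
    near = ≤-trans large′ (+-monoʳ-≤ 4 (*-monoʳ-≤ 4 (≤-trans (+-mono-≤ p≤ cross≤) (≤-reflexive (+-comm ⌊ i /2⌋ (j * i))))))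
    -- Both numbers lie within rounding of n(n + 1)/4: 4 · `size i j` ≤ n(n + 1) < 4 · (e + 1).
    size≤ : size i j ≤ p + cross
    size≤ = ≤-pred (*-cancelˡ-< 4 _ _ (begin-strict
      4 * size i j              ≤⟨ 4*size≤ i j ⟩
      (i + j) * suc (i + j)     <⟨ large′ ⟩
      4 + 4 * (p + cross)       ≡⟨ *-suc 4 (p + cross) ⟨
      4 * suc (p + cross)       ∎))
    cross-max : j * i ≤ cross
    cross-max = +-cancelʳ-≤ ⌊ i /2⌋ _ _ (≤-trans size≤ (≤-trans (+-monoˡ-≤ cross p≤) (≤-reflexive (+-comm ⌊ i /2⌋ cross))))
    p-max : ⌊ i /2⌋ ≤ p
    p-max = +-cancelˡ-≤ (j * i) _ _ (≤-trans size≤ (≤-trans (+-monoʳ-≤ p cross≤) (≤-reflexive (+-comm p (j * i)))))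
    complete : All (λ v → All (λ w → adj G v w ≡ true) L) Y
    complete = All.map (λ {v} full → All.map 𝟙≡1 (sum-map-max {k = 1} (All.universal (λ w → 𝟙≤1 (adj G v w)) L)
      (≤-reflexive (≡-trans (*-identityʳ i) (≡-sym full))))) (sum-map-max deg≤ cross-max)
    layout : Layout i (L ++ Y)
    layout = paired⇒layout paired (≤-trans (n≤1+⌊n/2⌋*2 i) (s≤s (*-monoˡ-≤ 2 p-max))) (All-resp-↭ τ X⊆) Y⊆
      (All.tabulate λ w∈ → All.tabulate λ v∈ → ~-sym G (All.lookup (All.lookup complete v∈) w∈))

-- Extremality as a numerical threshold

Large : ∀ {n} → Graph n → Set
Large {n} G = n * suc n < 4 + 4 * e G (allFin n)

module _ {n : ℕ} (G : Graph n) where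

  private
    S = allFin n
    len : length S ≡ n
    len = length-tabulate id

  e-bound-allFin : FanFree G → 5 ≤ n → 4 * e G S ≤ n * suc n
  e-bound-allFin free 5≤n with occurs? (isK₄? G) S
  ... | no noK = subst (λ l → 4 * e G S ≤ l * suc l) len (e-bound G free _ S ≤-refl (allFin⁺ n) noK)
  ... | yes K = +-cancelʳ-≤ 4 _ _ (begin
    -- At `n` ≥ 5 at least one vertex remains beside the K₄, and the 4 it wins back cancels the
    -- allowance.
    4 * e G S + 4                                    ≤⟨ +-monoʳ-≤ (4 * e G S) (*-monoʳ-≤ 4 (⊓-mono-≤ (∸-monoˡ-≤ 4 5≤n) (m≤m+n 1 1))) ⟩
    4 * e G S + 4 * ((n ∸ 4) ⊓ 2)                    ≤⟨ subst (λ l → 4 * e G S + 4 * ((l ∸ 4) ⊓ 2) ≤ 4 + l * suc l) len (e-bound-K₄ G free S (allFin⁺ n) K) ⟩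
    4 + n * suc n                                    ≡⟨ +-comm 4 _ ⟩
    n * suc n + 4                                    ∎)
    where open ≤-Reasoning

  -- With two or more vertices beside the K₄ the gain is 8: the allowance and one whole edge.
  large⇒noK₄ : FanFree G → 6 ≤ n → Large G → ¬ Occurs (IsK₄ G) S
  large⇒noK₄ free 6≤n large K = contradiction large (≤⇒≯ (+-cancelʳ-≤ 4 _ _ (begin
    4 + 4 * e G S + 4                                ≡⟨ rearrange (4 * e G S) ⟩
    4 * e G S + 8                                    ≤⟨ +-monoʳ-≤ (4 * e G S) (*-monoʳ-≤ 4 (⊓-mono-≤ (∸-monoˡ-≤ 4 6≤n) ≤-refl)) ⟩
    4 * e G S + 4 * ((n ∸ 4) ⊓ 2)                    ≤⟨ subst (λ l → 4 * e G S + 4 * ((l ∸ 4) ⊓ 2) ≤ 4 + l * suc l) len (e-bound-K₄ G free S (allFin⁺ n) K) ⟩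
    4 + n * suc n                                    ≡⟨ +-comm 4 _ ⟩
    n * suc n + 4                                    ∎)))
    where
    open ≤-Reasoning
    rearrange : ∀ x → 4 + x + 4 ≡ x + 8
    rearrange = solve-∀

-- Every competitor has 4e ≤ n(n + 1), so passing the threshold means that no competitor is ahead by
-- an edge.
large⇒extremal : ∀ {n} {G : Graph n} → 5 ≤ n → FanFree G → Large G → Extremal G
large⇒extremal {n} {G} 5≤n free large = fanFree⇒P²₅-free {G = G} free , λ H H-free →
  subst₂ _≤_ (≡-sym (edges≡e H)) (≡-sym (edges≡e G)) (≤-pred (*-cancelˡ-< 4 _ _ (begin-strict
    4 * e H (allFin n)       ≤⟨ e-bound-allFin H (P²₅-free⇒fanFree {G = H} H-free) 5≤n ⟩
    n * suc n                <⟨ large ⟩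
    4 + 4 * e G (allFin n)   ≡⟨ *-suc 4 (e G (allFin n)) ⟨
    4 * suc (e G (allFin n)) ∎)))
  where open ≤-Reasoning

-- One fan-free graph `H` above the threshold lifts every extremal graph above it.
extremal⇒large : ∀ {n} {G H : Graph n} → FanFree H → Large H → Extremal G → Large G
extremal⇒large {G = G} {H} free large (_ , max) = ≤-trans large (+-monoʳ-≤ 4 (*-monoʳ-≤ 4
  (subst₂ _≤_ (edges≡e H) (edges≡e G) (max H (fanFree⇒P²₅-free {G = H} free)))))

E-fanFree : ∀ n i → FanFree (E n i)
E-fanFree n i = sides⇒fanFree (E-sides n i)

E-large : ∀ {r n i} → n % 4 ≡ r → ExtremalSize r n i → Large (E n i)
E-large {i = i} n%4≡r size with extremalSize⇒balanced n%4≡r size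
... | j , balanced , refl rewrite e-E i j = balanced⇒nearMaximal balanced

≅E⇒extremal : ∀ {r n i} {G : Graph n} → 5 ≤ n → n % 4 ≡ r → ExtremalSize r n i → G ≅ E n i → Extremal G
≅E⇒extremal {n = n} {i} 5≤n n%4≡r size G≅E = large⇒extremal 5≤n (fanFree-≅ G≅E (E-fanFree n i))
  (subst (λ x → n * suc n < 4 + 4 * x) (≡-sym (e-≅ G≅E)) (E-large n%4≡r size))

large⇒≅E : ∀ {r n} {G : Graph n} → 5 ≤ n → n % 4 ≡ r → FanFree G → ¬ Occurs (IsK₄ G) (allFin n) → Large G →
  ∃ λ i → ExtremalSize r n i × G ≅ E n i
large⇒≅E {r} {n} {G} 5≤n n%4≡r free noK large =
  resize (sides⇒≅E G (proj₂ (extremal-sides G free noK 5≤n large)) large)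
  where
  resize : (∃₂ λ i j → i + j ≡ n × NearMaximal i j × G ≅ E n i) → ∃ λ i → ExtremalSize r n i × G ≅ E n i
  resize (i , j , i+j≡n , near , G≅E) with nearMaximal⇒balanced i j near
  ... | r′ , balanced with balanced⇒extremalSize balanced
  ...   | sum%4≡r′ , size = i , subst₂ (λ r n → ExtremalSize r n i)
    (≡-trans (≡-sym sum%4≡r′) (≡-trans (cong (_% 4) i+j≡n) n%4≡r)) i+j≡n size , G≅E

extremal⇒≅E : ∀ {r n i₀} {G : Graph n} → 6 ≤ n → n % 4 ≡ r → ExtremalSize r n i₀ → Extremal G →
  ∃ λ i → ExtremalSize r n i × G ≅ E n i
extremal⇒≅E {n = n} {i₀} {G} 6≤n n%4≡r size extremal =
  large⇒≅E (≤-trans (n≤1+n 5) 6≤n) n%4≡r free (large⇒noK₄ G free 6≤n large) large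
  where
  free = P²₅-free⇒fanFree {G = G} (proj₁ extremal)
  large = extremal⇒large {G = G} (E-fanFree n i₀) (E-large n%4≡r size) extremal

-- K₄ with a pendant edge

pendant⇒fanFree : ∀ {G : Graph 5} {t d} → (∀ y → adj G t y ≡ true → y ≡ d) → FanFree G
pendant⇒fanFree {G} {t} {d} leaf c p q r s cp cq cr cs pq qr rs p≢r p≢s q≢s
  with extract {xs = allFin 5} uS (All.universal ∈-allFin (t ∷ c ∷ p ∷ q ∷ r ∷ s ∷ []))
  where
  -- Each vertex of a fan has two distinct neighbours, so the leaf `t` would be a sixth vertex.
  t≢ : ∀ {x y z} → adj G x y ≡ true → adj G x z ≡ true → ¬ y ≡ z → ¬ t ≡ x
  t≢ {x} {y} {z} xy xz y≢z refl = y≢z (≡-trans (leaf y xy) (≡-sym (leaf z xz)))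
  uS : Unique (t ∷ c ∷ p ∷ q ∷ r ∷ s ∷ [])
  uS = (t≢ cp cq (~⇒≢ G pq) ∷ t≢ (~-sym G cp) pq (~⇒≢ G cq) ∷ t≢ (~-sym G cq) qr (~⇒≢ G cr)
      ∷ t≢ (~-sym G cr) rs (~⇒≢ G cs) ∷ t≢ (~-sym G cs) (~-sym G rs) (~⇒≢ G cr) ∷ [])
    ∷ (~⇒≢ G cp ∷ ~⇒≢ G cq ∷ ~⇒≢ G cr ∷ ~⇒≢ G cs ∷ []) ∷ (~⇒≢ G pq ∷ p≢r ∷ p≢s ∷ [])
    ∷ (~⇒≢ G qr ∷ q≢s ∷ []) ∷ (~⇒≢ G rs ∷ []) ∷ [] ∷ []
... | _ , σ with ↭-length σ
...   | ()

G₀-fanFree : FanFree G₀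
G₀-fanFree =
  pendant⇒fanFree {G₀} {suc (suc (suc (suc zero)))} {suc (suc (suc zero))} leaf
  where
  leaf : ∀ y → adj G₀ (suc (suc (suc (suc zero)))) y ≡ true → y ≡ suc (suc (suc zero))
  leaf (suc (suc (suc zero))) _ = refl
  leaf zero ()
  leaf (suc zero) ()
  leaf (suc (suc zero)) ()
  leaf (suc (suc (suc (suc zero)))) ()

G₀-large : Large G₀
-- `G₀` has 7 edges, and 30 < 4 + 4 · 7.
G₀-large = m≤m+n 31 1

module _ {G : Graph 5} where

  private
    infix 4 _≈_
    _≈_ = _~_ G
    ~s = ~-sym G

  pendant⇒≅G₀ : ∀ {a b c d v} → IsK₄ G (a ∷ b ∷ c ∷ d ∷ []) → All (λ t → ¬ t ≡ v) (a ∷ b ∷ c ∷ d ∷ []) → v ≈ d →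
    adj G v a ≡ false → adj G v b ≡ false → adj G v c ≡ false → G ≅ G₀
  pendant⇒≅G₀ {a} {b} {c} {d} {v} (ab , ac , ad , bc , bd , cd) (a≢v ∷ b≢v ∷ c≢v ∷ d≢v ∷ []) vd va vb vc =
    injective⇒≅ (lookup S) (lookup-injective uS) (symmetric-ext G₀ G (lookup S) forward)
    where
    S = a ∷ b ∷ c ∷ d ∷ v ∷ []
    uS : Unique S
    uS = (~⇒≢ G ab ∷ ~⇒≢ G ac ∷ ~⇒≢ G ad ∷ a≢v ∷ []) ∷ (~⇒≢ G bc ∷ ~⇒≢ G bd ∷ b≢v ∷ []) ∷ (~⇒≢ G cd ∷ c≢v ∷ []) ∷ (d≢v ∷ []) ∷ [] ∷ []
    forward : ∀ p q → toℕ p < toℕ q → adj G₀ p q ≡ adj G (lookup S p) (lookup S q)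
    forward zero (suc zero) _ = ≡-sym ab
    forward zero (suc (suc zero)) _ = ≡-sym ac
    forward zero (suc (suc (suc zero))) _ = ≡-sym ad
    forward zero (suc (suc (suc (suc zero)))) _ = ≡-sym (≡-trans (sym G a v) va)
    forward (suc zero) (suc (suc zero)) _ = ≡-sym bc
    forward (suc zero) (suc (suc (suc zero))) _ = ≡-sym bd
    forward (suc zero) (suc (suc (suc (suc zero)))) _ = ≡-sym (≡-trans (sym G b v) vb)
    forward (suc (suc zero)) (suc (suc (suc zero))) _ = ≡-sym cd
    forward (suc (suc zero)) (suc (suc (suc (suc zero)))) _ = ≡-sym (≡-trans (sym G c v) vc)
    forward (suc (suc (suc zero))) (suc (suc (suc (suc zero)))) _ = ≡-sym (~s vd)
    forward (suc _) (suc zero) (s≤s ())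
    forward (suc (suc _)) (suc (suc zero)) (s≤s (s≤s ()))
    forward (suc (suc (suc _))) (suc (suc (suc zero))) (s≤s (s≤s (s≤s ())))
    forward (suc (suc (suc (suc zero)))) (suc (suc (suc (suc zero)))) (s≤s (s≤s (s≤s (s≤s ()))))

  -- The 6 edges of the K₄ give only 4 + 4 · 6 = 28, below the required 30, so the fifth vertex has
  -- a neighbour; fan-freeness allows just one.
  K₄⇒≅G₀ : FanFree G → Large G → Occurs (IsK₄ G) (allFin 5) → G ≅ G₀
  K₄⇒≅G₀ free large (a ∷ b ∷ c ∷ d ∷ [] , a∈ ∷ b∈ ∷ c∈ ∷ d∈ ∷ [] , K@(ab , ac , ad , bc , bd , cd)) =
    fifth (extract uQ (a∈ ∷ b∈ ∷ c∈ ∷ d∈ ∷ []))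
    where
    Q = a ∷ b ∷ c ∷ d ∷ []
    uQ : Unique Q
    uQ = (~⇒≢ G ab ∷ ~⇒≢ G ac ∷ ~⇒≢ G ad ∷ []) ∷ (~⇒≢ G bc ∷ ~⇒≢ G bd ∷ []) ∷ (~⇒≢ G cd ∷ []) ∷ [] ∷ []
    attach : ∀ v → ¬ deg G v Q ≡ 0 → All (λ t → ¬ t ≡ v) Q → AllPairs (λ x y → v ≈ x → v ≈ y → ⊥) Q → G ≅ G₀
    attach v deg≢0 v∉@(a≢v ∷ b≢v ∷ c≢v ∷ d≢v ∷ [])
      ((¬ab ∷ ¬ac ∷ ¬ad ∷ []) ∷ (¬bc ∷ ¬bd ∷ []) ∷ (¬cd ∷ []) ∷ [] ∷ [])
      with _~?_ G v a | _~?_ G v b | _~?_ G v c | _~?_ G v d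
    ... | yes va | _ | _ | _ =
      pendant⇒≅G₀ (bc , bd , ~s ab , cd , ~s ac , ~s ad) (b≢v ∷ c≢v ∷ d≢v ∷ a≢v ∷ []) va (¬-not (¬ab va)) (¬-not (¬ac va)) (¬-not (¬ad va))
    ... | no va | yes vb | _ | _ =
      pendant⇒≅G₀ (ac , ad , ab , cd , ~s bc , ~s bd) (a≢v ∷ c≢v ∷ d≢v ∷ b≢v ∷ []) vb (¬-not va) (¬-not (¬bc vb)) (¬-not (¬bd vb))
    ... | no va | no vb | yes vc | _ =
      pendant⇒≅G₀ (ab , ad , ac , bd , bc , ~s cd) (a≢v ∷ b≢v ∷ d≢v ∷ c≢v ∷ []) vc (¬-not va) (¬-not vb) (¬-not (¬cd vc))
    ... | no va | no vb | no vc | yes vd = pendant⇒≅G₀ K v∉ vd (¬-not va) (¬-not vb) (¬-not vc)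
    ... | no va | no vb | no vc | no vd =
      contradiction (deg-none G (¬-not va ∷ ¬-not vb ∷ ¬-not vc ∷ ¬-not vd ∷ [])) deg≢0
    fifth : (∃ λ U → allFin 5 ↭ Q ++ U) → G ≅ G₀
    fifth ([] , σ) = contradiction (↭-length σ) λ ()
    fifth (_ ∷ _ ∷ _ , σ) = contradiction (↭-length σ) λ ()
    fifth (v ∷ [] , σ) with Unique-++⁻ Q (Unique-resp-↭ σ (allFin⁺ 5))
    ... | _ , v∉ ∷ [] = attach v deg≢0 v∉ (K₄-neighbours G free K v∉)
      where
      e≡ : e G (allFin 5) ≡ 6 + (deg G v Q + 0 + 0)
      e≡ = ≡-trans (e-↭ G σ) (≡-trans (e-++ G Q (v ∷ [])) (cong (_+ (deg G v Q + 0 + 0)) (e-K₄ G K)))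
      deg≢0 : ¬ deg G v Q ≡ 0
      deg≢0 deg≡0 = ≤⇒≯ (m≤m+n 28 2) (subst (λ x → 30 < 4 + 4 * x) (≡-trans e≡ (cong (λ x → 6 + (x + 0 + 0)) deg≡0)) large)

-- The classification by residue

theorem4 : (∀ (G : Graph 5) → Extremal G ⇔ (G ≅ E 5 2 ⊎ G ≅ E 5 3 ⊎ G ≅ G₀))
    × (∀ (n : ℕ) → 6 ≤ n → n % 4 ≡ 1 → ∀ (G : Graph n) →
    Extremal G ⇔ (G ≅ E n ⌈ n /2⌉ ⊎ G ≅ E n ⌊ n /2⌋))
    × (∀ (n : ℕ) → 6 ≤ n → n % 4 ≡ 2 → ∀ (G : Graph n) →
    Extremal G ⇔ (G ≅ E n ⌊ n /2⌋ ⊎ G ≅ E n (⌊ n /2⌋ + 1)))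
    × (∀ (n : ℕ) → 6 ≤ n → (n % 4 ≡ 0 ⊎ n % 4 ≡ 3) → ∀ (G : Graph n) →
    Extremal G ⇔ G ≅ E n ⌈ n /2⌉)
theorem4 = five , one , two , zero-or-three
  where
  5≤_ : ∀ {n} → 6 ≤ n → 5 ≤ n
  5≤ 6≤n = ≤-trans (n≤1+n 5) 6≤n

  five : ∀ (G : Graph 5) → Extremal G ⇔ (G ≅ E 5 2 ⊎ G ≅ E 5 3 ⊎ G ≅ G₀)
  five G = mk⇔ to λ
    { (inj₁ G≅E) → ≅E⇒extremal ≤-refl refl (inj₂ refl) G≅E
    ; (inj₂ (inj₁ G≅E)) → ≅E⇒extremal ≤-refl refl (inj₁ refl) G≅E
    ; (inj₂ (inj₂ G≅G₀)) → large⇒extremal {G = G} ≤-refl (fanFree-≅ G≅G₀ G₀-fanFree)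
        (subst (λ x → 30 < 4 + 4 * x) (≡-sym (e-≅ G≅G₀)) G₀-large)
    }
    where
    module _ (extremal : Extremal G) where
      free : FanFree G
      free = P²₅-free⇒fanFree {G = G} (proj₁ extremal)
      large : Large G
      large = extremal⇒large {G = G} {G₀} G₀-fanFree G₀-large extremal
      sizes : (∃ λ i → ExtremalSize 1 5 i × G ≅ E 5 i) → G ≅ E 5 2 ⊎ G ≅ E 5 3 ⊎ G ≅ G₀
      sizes (_ , inj₁ refl , G≅E) = inj₂ (inj₁ G≅E)
      sizes (_ , inj₂ refl , G≅E) = inj₁ G≅E
      cases : Dec (Occurs (IsK₄ G) (allFin 5)) → G ≅ E 5 2 ⊎ G ≅ E 5 3 ⊎ G ≅ G₀
      cases (yes K) = inj₂ (inj₂ (K₄⇒≅G₀ free large K))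
      cases (no noK) = sizes (large⇒≅E ≤-refl refl free noK large)
    to : Extremal G → G ≅ E 5 2 ⊎ G ≅ E 5 3 ⊎ G ≅ G₀
    to extremal = cases extremal (occurs? (isK₄? G) (allFin 5))

  one : ∀ n → 6 ≤ n → n % 4 ≡ 1 → ∀ (G : Graph n) → Extremal G ⇔ (G ≅ E n ⌈ n /2⌉ ⊎ G ≅ E n ⌊ n /2⌋)
  one n 6≤n n%4 G = mk⇔ (cases ∘ extremal⇒≅E 6≤n n%4 (inj₁ refl)) λ
    { (inj₁ G≅E) → ≅E⇒extremal (5≤ 6≤n) n%4 (inj₁ refl) G≅E
    ; (inj₂ G≅E) → ≅E⇒extremal (5≤ 6≤n) n%4 (inj₂ refl) G≅E
    }
    where
    cases : (∃ λ i → ExtremalSize 1 n i × G ≅ E n i) → G ≅ E n ⌈ n /2⌉ ⊎ G ≅ E n ⌊ n /2⌋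
    cases (_ , inj₁ refl , G≅E) = inj₁ G≅E
    cases (_ , inj₂ refl , G≅E) = inj₂ G≅E

  two : ∀ n → 6 ≤ n → n % 4 ≡ 2 → ∀ (G : Graph n) → Extremal G ⇔ (G ≅ E n ⌊ n /2⌋ ⊎ G ≅ E n (⌊ n /2⌋ + 1))
  two n 6≤n n%4 G = mk⇔ (cases ∘ extremal⇒≅E 6≤n n%4 (inj₁ refl)) λ
    { (inj₁ G≅E) → ≅E⇒extremal (5≤ 6≤n) n%4 (inj₁ refl) G≅E
    ; (inj₂ G≅E) → ≅E⇒extremal (5≤ 6≤n) n%4 (inj₂ refl) G≅E
    }
    where
    cases : (∃ λ i → ExtremalSize 2 n i × G ≅ E n i) → G ≅ E n ⌊ n /2⌋ ⊎ G ≅ E n (⌊ n /2⌋ + 1)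
    cases (_ , inj₁ refl , G≅E) = inj₁ G≅E
    cases (_ , inj₂ refl , G≅E) = inj₂ G≅E

  zero-or-three : ∀ n → 6 ≤ n → n % 4 ≡ 0 ⊎ n % 4 ≡ 3 → ∀ (G : Graph n) → Extremal G ⇔ G ≅ E n ⌈ n /2⌉
  zero-or-three n 6≤n (inj₁ n%4) G = mk⇔ (λ { extremal → cases (extremal⇒≅E 6≤n n%4 refl extremal) })
    (≅E⇒extremal (5≤ 6≤n) n%4 refl)
    where
    cases : (∃ λ i → i ≡ ⌈ n /2⌉ × G ≅ E n i) → G ≅ E n ⌈ n /2⌉
    cases (_ , refl , G≅E) = G≅E
  zero-or-three n 6≤n (inj₂ n%4) G = mk⇔ (λ { extremal → cases (extremal⇒≅E 6≤n n%4 refl extremal) })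
    (≅E⇒extremal (5≤ 6≤n) n%4 refl)
    where
    cases : (∃ λ i → i ≡ ⌈ n /2⌉ × G ≅ E n i) → G ≅ E n ⌈ n /2⌉
    cases (_ , refl , G≅E) = G≅E
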